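{- Let $m$ and $r$ be nonnegative integers, and let $C$ and $D$ be sets of nonnegative integers such that $C \cup D = [0, m]$, $C \cap D = \{r\}$ and $0 \in C$. Then $R_{C}(n) = R_{D}(n)$ for every positive integer $n$ if and only if there exists a natural number $l$ such that $C = A_{2l} \cup (2^{2l} - 1 + B_{2l})$ and $D = B_{2l} \cup (2^{2l} - 1 + A_{2l})$.
   Context: Natural numbers are nonnegative integers, $\mathbb{N} = \{0,1,2,\dots\}$, and $[a,b]$ denotes the set of integers $x$ with $a \le x \le b$. For a set $S$ of nonnegative integers, $R_S(n)$ denotes the number of solutions of $s + s' = n$ with $s, s' \in S$ and $s < s'$. $A$ is the set of those nonnegative integers whose binary representation contains an even number of digits $1$ (so $0 \in A$), and $B = \mathbb{N} \setminus A$. For a natural number $l$, $A_l = A \cap [0, 2^l - 1]$ and $B_l = B \cap [0, 2^l - 1]$ (so $A_{2l} = A \cap [0, 2^{2l}-1]$ and $B_{2l} = B \cap [0, 2^{2l}-1]$). For a nonnegative integer $a$ and a set $S$ of nonnegative integers, $a + S = \{a + b : b \in S\}$. -}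

module Defs where

open import Data.Digit using (toDigits; 1b)
open import Data.Fin.Properties using () renaming (_≟_ to _≟ᶠ_)
open import Data.List.Base using (filter; length; upTo; cartesianProduct)
open import Data.Nat.Base using (ℕ; suc; _+_; _^_; _∸_; _≤_)
open import Data.Nat.Divisibility using (_∣_)
open import Data.Nat.Properties using (_≟_; _<?_)
open import Data.Product.Base using (_×_; _,_; proj₁; ∃-syntax)
open import Level using (0ℓ)
open import Relation.Binary.PropositionalEquality using (_≡_)
open import Relation.Nullary.Decidable using (_×-dec_)
open import Relation.Unary using (Pred; Decidable; _∈_; _∩_; ∁)

infixr 8 _+ˢ_

[_⋯_] : ℕ → ℕ → Pred ℕ 0ℓ
[ a ⋯ b ] x = a ≤ x × x ≤ b

_+ˢ_ : ℕ → Pred ℕ 0ℓ → Pred ℕ 0ℓ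
(a +ˢ S) x = ∃[ b ] (b ∈ S × x ≡ a + b)

-- The number of pairs (s , s′) with s , s′ ∈ S, s < s′ and s + s′ ≡ n.
-- Such pairs have s , s′ ≤ n, so it suffices to search {0,…,n}².  The
-- value does not depend on which decision procedure for S is supplied.
R : {S : Pred ℕ 0ℓ} → Decidable S → ℕ → ℕ
R S? n = length (filter solution? (cartesianProduct (upTo (suc n)) (upTo (suc n))))
  where
  solution? = λ ((s , s′) : ℕ × ℕ) →
    S? s ×-dec S? s′ ×-dec (s <? s′) ×-dec (s + s′ ≟ n)

-- toDigits may produce leading zeros; these do not affect the count.
binaryOnes : ℕ → ℕ
binaryOnes n = length (filter (_≟ᶠ 1b) (proj₁ (toDigits 2 n)))

A : Pred ℕ 0ℓ
A n = 2 ∣ binaryOnes n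

B : Pred ℕ 0ℓ
B = ∁ A

Aₗ : ℕ → Pred ℕ 0ℓ
Aₗ l = A ∩ [ 0 ⋯ 2 ^ l ∸ 1 ]

Bₗ : ℕ → Pred ℕ 0ℓ
Bₗ l = B ∩ [ 0 ⋯ 2 ^ l ∸ 1 ]

{-# OPTIONS --safe #-}
module Submission where

-- Put f = 1_C − 1_D. Equality of R_C and R_D says f(x)·u(x) = f(x²) for the generating series,
-- where u(x) = 1 + x + ⋯ + xᵐ + xʳ; multiplying by 1 − x gives a recurrence for the coefficients
-- of f. Below r it forces f to be the Thue–Morse sequence t, and between r and 2r it forces t to
-- repeat its initial segment with a shift, which is possible only if r + 1 = 4ˡ. If m > 2r the
-- recurrence fails at index 2r + 2 or 3r + 2; if m < 2r it produces two complementary shifts of t,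
-- excluded by descent on binary digits. Conversely f(x) = (1 − xʳ) ∏_{i<2l} (1 − x^{2^i}) satisfies the
-- recurrence.

open import Defs
open import Data.Digit using (fromDigits; toDigits; Expansion; 0b; 1b)
open import Data.Empty using (⊥)
import Data.Fin.Base as Fin
open import Data.Fin.Properties using () renaming (_≟_ to _≟ᶠ_)
open import Data.Integer.Base as ℤ using (ℤ; 0ℤ; 1ℤ; -1ℤ; _-_; -_) renaming (+_ to ⁺_)
import Data.Integer.Properties as ℤ
open import Data.Integer.Tactic.RingSolver using (solve-∀)
open import Data.List.Base using ([]; _∷_; filter; length; upTo; applyUpTo; cartesianProduct; map; _++_)
import Data.List.Properties as List
open import Data.Nat.Base using (ℕ; zero; suc; _+_; _*_; _^_; _∸_; _<_; _≤_; s≤s; z≤n; s<s; z<s)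
open import Data.Nat.Divisibility using (_∣_; divides; m∣m*n)
open import Data.Nat.Induction using (Acc; acc; <-wellFounded; <-rec)
import Data.Nat.Properties as ℕ
import Data.Nat.Tactic.RingSolver as ℕ-Solver
open import Data.Product.Base using (_×_; _,_; proj₁; proj₂; ∃-syntax)
open import Data.Sum.Base using (_⊎_; inj₁; inj₂; [_,_]′)
open import Function.Base using (_∘_; id; flip)
open import Function.Bundles using (_⇔_; mk⇔; Equivalence)
open import Level using (0ℓ)
open import Relation.Binary.Definitions using (tri<; tri≈; tri>)
open import Relation.Binary.PropositionalEquality
  using (_≡_; _≢_; _≗_; refl; sym; trans; cong; cong₂; subst; module ≡-Reasoning)
open import Relation.Nullary using (¬_; Dec; yes; no; contradiction)
open import Relation.Nullary.Decidable using (_×-dec_)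
open import Relation.Unary using (Pred; Decidable; _∈_; _∩_; _∪_; _≐_; ｛_｝)
import Algebra.Properties.AbelianGroup ℤ.+-0-abelianGroup as ℤ+

-- The functional equation rests on C(x)² = 2 R_C(x) + C(x²) together with C² - D² = (C + D)(C - D),
-- where C + D = u because the sets cover [0, m] and overlap only in r. Multiplying by 1 - x
-- collapses the block 1 + ⋯ + xᵐ, so a coefficient involves only four values of f and f at half the
-- index. Thue-Morse enters because t(x) = (1 - x) t(x²).
--
-- The obstacle is that m is unknown while r is being determined. At an index n between r and 2r
-- either n ≤ m, and f n is unknown, or n > m, and f (n - m - 1) appears instead. At odd offsets
-- from r the two known shifted terms reinforce each other to ±2, so this unknown cannot absorb a
-- third term of the same sign. The resulting relation concerns t alone; it fixes r before m is
-- compared with 2r.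

data Half : ℕ → Set where
  even : ∀ k → Half (2 * k)
  odd  : ∀ k → Half (suc (2 * k))

half : ∀ n → Half n
half zero = even 0
half (suc n) with half n
... | even k = odd k
... | odd k  = subst Half (ℕ.*-suc 2 k) (even (suc k))

-- Sequences ℕ → ℤ are treated as formal power series.

shift : ℕ → (ℕ → ℤ) → ℕ → ℤ
shift zero    f n       = f n
shift (suc k) f zero    = 0ℤ
shift (suc k) f (suc n) = shift k f n

-- The monomial xᵏ, and equally the Kronecker symbol that selects a diagonal i = j or a sum i + j =
-- n.
δ : ℕ → ℕ → ℤ
δ zero    zero    = 1ℤ
δ zero    (suc n) = 0ℤ
δ (suc k) zero    = 0ℤ
δ (suc k) (suc n) = δ k n

-- Multiplication by 1 - x.
Δ : (ℕ → ℤ) → ℕ → ℤ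
Δ f zero    = f 0
Δ f (suc n) = f (suc n) - f n

-- The series f(x²).
dilate : (ℕ → ℤ) → ℕ → ℤ
dilate f zero          = f 0
dilate f (suc zero)    = 0ℤ
dilate f (suc (suc n)) = dilate (f ∘ suc) n

-- A general weight `w i j` instead of a product f i · g j: the condition i < j in the definition of
-- R does not factor.
antidiag : (ℕ → ℕ → ℤ) → ℕ → ℤ
antidiag w zero    = w 0 0
antidiag w (suc n) = w 0 (suc n) ℤ.+ antidiag (w ∘ suc) n

_⊛_ : (ℕ → ℤ) → (ℕ → ℤ) → ℕ → ℤ
(f ⊛ g) n = antidiag (λ i j → f i ℤ.* g j) n

shift-at : ∀ {f n} k {j} → n ≡ k + j → shift k f n ≡ f j
shift-at zero    refl = refl
shift-at (suc k) refl = shift-at k refl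

shift-< : ∀ {f k n} → n < k → shift k f n ≡ 0ℤ
shift-< {n = zero}  (s≤s _)   = refl
shift-< {n = suc n} (s≤s n<k) = shift-< n<k

shift-shift : ∀ f j k n → shift j (shift k f) n ≡ shift (j + k) f n
shift-shift f zero    k n       = refl
shift-shift f (suc j) k zero    = refl
shift-shift f (suc j) k (suc n) = shift-shift f j k n

shift-cong : ∀ {f g} k → f ≗ g → shift k f ≗ shift k g
shift-cong zero    e n       = e n
shift-cong (suc k) e zero    = refl
shift-cong (suc k) e (suc n) = shift-cong k e n

shift-- : ∀ f g k n → shift k (λ i → f i - g i) n ≡ shift k f n - shift k g n
shift-- f g zero    n       = refl
shift-- f g (suc k) zero    = refl
shift-- f g (suc k) (suc n) = shift-- f g k n

dilate-even : ∀ f k → dilate f (2 * k) ≡ f k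
dilate-even f zero    = refl
dilate-even f (suc k) rewrite ℕ.+-suc k (k + 0) = dilate-even (f ∘ suc) k

dilate-odd : ∀ f k → dilate f (suc (2 * k)) ≡ 0ℤ
dilate-odd f zero    = refl
dilate-odd f (suc k) rewrite ℕ.+-suc k (k + 0) = dilate-odd (f ∘ suc) k

Δdilate-even : ∀ f {n} k → n ≡ 2 * k → Δ (dilate f) n ≡ f k
Δdilate-even f zero    refl = refl
Δdilate-even f (suc k) refl rewrite ℕ.+-suc k (k + 0)
  | dilate-even (f ∘ suc) k | dilate-odd f k = ℤ.+-identityʳ _

Δdilate-odd : ∀ f {n} k → n ≡ suc (2 * k) → Δ (dilate f) n ≡ - f k
Δdilate-odd f k refl rewrite dilate-odd f k | dilate-even f k = ℤ.+-identityˡ _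

-- Coefficient n involves only the value at ⌊n/2⌋; this makes the recurrence a genuine recursion.
Δdilate-cong : ∀ {f g} n → (∀ k → 2 * k ≤ n → f k ≡ g k) → Δ (dilate f) n ≡ Δ (dilate g) n
Δdilate-cong {f} {g} n e with half n
... | even k = trans (Δdilate-even f k refl) (trans (e k ℕ.≤-refl) (sym (Δdilate-even g k refl)))
... | odd k  = trans (Δdilate-odd f k refl) (trans (cong -_ (e k (ℕ.n≤1+n _))) (sym (Δdilate-odd g k refl)))

Δ-injective : ∀ {f g} → Δ f ≗ Δ g → f ≗ g
Δ-injective e zero = e 0
Δ-injective {f} {g} e (suc n) = begin
  f (suc n)                  ≡⟨ rearrange (f (suc n)) (f n) ⟩
  Δ f (suc n) ℤ.+ f n        ≡⟨ cong₂ ℤ._+_ (e (suc n)) (Δ-injective e n) ⟩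
  Δ g (suc n) ℤ.+ g n        ≡⟨ rearrange (g (suc n)) (g n) ⟨
  g (suc n)                  ∎
  where
  open ≡-Reasoning
  rearrange : ∀ x y → x ≡ (x - y) ℤ.+ y
  rearrange = solve-∀

Δ-cong : ∀ {f g} → f ≗ g → Δ f ≗ Δ g
Δ-cong e zero    = e 0
Δ-cong e (suc n) = cong₂ _-_ (e (suc n)) (e n)

antidiag-cong : ∀ {v w} → (∀ i j → v i j ≡ w i j) → antidiag v ≗ antidiag w
antidiag-cong e zero    = e 0 0
antidiag-cong e (suc n) = cong₂ ℤ._+_ (e 0 (suc n)) (antidiag-cong (e ∘ suc) n)

antidiag-+ : ∀ v w n → antidiag (λ i j → v i j ℤ.+ w i j) n ≡ antidiag v n ℤ.+ antidiag w n
antidiag-+ v w zero = refl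
antidiag-+ v w (suc n) rewrite antidiag-+ (v ∘ suc) (w ∘ suc) n =
  interchange (v 0 (suc n)) (w 0 (suc n)) (antidiag (v ∘ suc) n) (antidiag (w ∘ suc) n)
  where
  interchange : ∀ a b c d → (a ℤ.+ b) ℤ.+ (c ℤ.+ d) ≡ (a ℤ.+ c) ℤ.+ (b ℤ.+ d)
  interchange = solve-∀

antidiag-- : ∀ v w n → antidiag (λ i j → v i j - w i j) n ≡ antidiag v n - antidiag w n
antidiag-- v w zero = refl
antidiag-- v w (suc n) rewrite antidiag-- (v ∘ suc) (w ∘ suc) n =
  interchange (v 0 (suc n)) (w 0 (suc n)) (antidiag (v ∘ suc) n) (antidiag (w ∘ suc) n)
  where
  interchange : ∀ a b c d → (a - b) ℤ.+ (c - d) ≡ (a ℤ.+ c) - (b ℤ.+ d)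
  interchange = solve-∀

antidiag-sucʳ : ∀ w n → antidiag w (suc n) ≡ antidiag (λ i j → w i (suc j)) n ℤ.+ w (suc n) 0
antidiag-sucʳ w zero    = refl
antidiag-sucʳ w (suc n) = trans
  (cong (λ x → w 0 (suc (suc n)) ℤ.+ x) (antidiag-sucʳ (w ∘ suc) n))
  (sym (ℤ.+-assoc (w 0 (suc (suc n))) _ _))

antidiag-flip : ∀ w n → antidiag (flip w) n ≡ antidiag w n
antidiag-flip w zero    = refl
antidiag-flip w (suc n) = begin
  w (suc n) 0 ℤ.+ antidiag (flip w ∘ suc) n            ≡⟨ cong (λ x → w (suc n) 0 ℤ.+ x) (antidiag-flip (λ i j → w i (suc j)) n) ⟩
  w (suc n) 0 ℤ.+ antidiag (λ i j → w i (suc j)) n     ≡⟨ ℤ.+-comm (w (suc n) 0) _ ⟩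
  antidiag (λ i j → w i (suc j)) n ℤ.+ w (suc n) 0     ≡⟨ antidiag-sucʳ w n ⟨
  antidiag w (suc n)                                   ∎
  where open ≡-Reasoning

antidiag-0 : ∀ n → antidiag (λ _ _ → 0ℤ) n ≡ 0ℤ
antidiag-0 zero    = refl
antidiag-0 (suc n) = trans (ℤ.+-identityˡ _) (antidiag-0 n)

-- Both ends of the antidiagonal lie off the diagonal and contribute 0. Removing them lowers n by
-- two, which matches the recursion of `dilate`.
antidiag-δ : ∀ g n → antidiag (λ i j → g i ℤ.* δ i j) n ≡ dilate g n
antidiag-δ g zero       = ℤ.*-identityʳ (g 0)
antidiag-δ g (suc zero) = cong₂ ℤ._+_ (ℤ.*-zeroʳ (g 0)) (ℤ.*-zeroʳ (g 1))
antidiag-δ g (suc (suc n)) = begin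
  g 0 ℤ.* 0ℤ ℤ.+ antidiag w (suc n)
    ≡⟨ cong₂ ℤ._+_ (ℤ.*-zeroʳ (g 0)) (antidiag-sucʳ w n) ⟩
  0ℤ ℤ.+ (antidiag (λ i j → g (suc i) ℤ.* δ i j) n ℤ.+ g (suc (suc n)) ℤ.* 0ℤ)
    ≡⟨ ℤ.+-identityˡ _ ⟩
  antidiag (λ i j → g (suc i) ℤ.* δ i j) n ℤ.+ g (suc (suc n)) ℤ.* 0ℤ
    ≡⟨ cong₂ ℤ._+_ (antidiag-δ (g ∘ suc) n) (ℤ.*-zeroʳ (g (suc (suc n)))) ⟩
  dilate (g ∘ suc) n ℤ.+ 0ℤ
    ≡⟨ ℤ.+-identityʳ _ ⟩
  dilate (g ∘ suc) n ∎
  where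
  open ≡-Reasoning
  w : ℕ → ℕ → ℤ
  w i j = g (suc i) ℤ.* δ (suc i) j

δ-⊛ : ∀ k f n → (δ k ⊛ f) n ≡ shift k f n
δ-⊛ zero    f zero    = ℤ.*-identityˡ (f 0)
δ-⊛ zero    f (suc n) = trans (cong₂ ℤ._+_ (ℤ.*-identityˡ (f (suc n))) (antidiag-0 n)) (ℤ.+-identityʳ _)
δ-⊛ (suc k) f zero    = refl
δ-⊛ (suc k) f (suc n) = trans (ℤ.+-identityˡ _) (δ-⊛ k f n)

Δ-⊛ : ∀ g f n → Δ (g ⊛ f) n ≡ (Δ g ⊛ f) n
Δ-⊛ g f zero    = refl
Δ-⊛ g f (suc n) = begin
  (g 0 ℤ.* f (suc n) ℤ.+ ((g ∘ suc) ⊛ f) n) - (g ⊛ f) n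
    ≡⟨ ℤ.+-assoc (g 0 ℤ.* f (suc n)) _ _ ⟩
  g 0 ℤ.* f (suc n) ℤ.+ (((g ∘ suc) ⊛ f) n - (g ⊛ f) n)
    ≡⟨ cong (λ x → g 0 ℤ.* f (suc n) ℤ.+ x) (antidiag-- (λ i j → g (suc i) ℤ.* f j) (λ i j → g i ℤ.* f j) n) ⟨
  g 0 ℤ.* f (suc n) ℤ.+ antidiag (λ i j → g (suc i) ℤ.* f j - g i ℤ.* f j) n
    ≡⟨ cong (λ x → g 0 ℤ.* f (suc n) ℤ.+ x) (antidiag-cong (λ i j → distrib (g (suc i)) (g i) (f j)) n) ⟩
  g 0 ℤ.* f (suc n) ℤ.+ antidiag (λ i j → (g (suc i) - g i) ℤ.* f j) n
    ∎
  where
  open ≡-Reasoning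
  distrib : ∀ a b c → a ℤ.* c - b ℤ.* c ≡ (a - b) ℤ.* c
  distrib = solve-∀

-- Counting representations

⟦_⟧ : ∀ {a} {P : Set a} → Dec P → ℤ
⟦ yes _ ⟧ = 1ℤ
⟦ no  _ ⟧ = 0ℤ

⟦⟧-yes : ∀ {a} {P : Set a} (P? : Dec P) → P → ⟦ P? ⟧ ≡ 1ℤ
⟦⟧-yes (yes _) _ = refl
⟦⟧-yes (no ¬p) p = contradiction p ¬p

⟦⟧-no : ∀ {a} {P : Set a} (P? : Dec P) → ¬ P → ⟦ P? ⟧ ≡ 0ℤ
⟦⟧-no (yes p) ¬p = contradiction p ¬p
⟦⟧-no (no _)  _  = refl

⟦⟧-⇔ : ∀ {a b} {P : Set a} {Q : Set b} (P? : Dec P) (Q? : Dec Q) → (P → Q) → (Q → P) → ⟦ P? ⟧ ≡ ⟦ Q? ⟧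
⟦⟧-⇔ (yes p) Q? to from = sym (⟦⟧-yes Q? (to p))
⟦⟧-⇔ (no ¬p) Q? to from = sym (⟦⟧-no Q? (¬p ∘ from))

⟦⟧-× : ∀ {a b} {P : Set a} {Q : Set b} (P? : Dec P) (Q? : Dec Q) → ⟦ P? ×-dec Q? ⟧ ≡ ⟦ P? ⟧ ℤ.* ⟦ Q? ⟧
⟦⟧-× (yes _) (yes _) = refl
⟦⟧-× (yes _) (no _)  = refl
⟦⟧-× (no _)  Q?      = sym (ℤ.*-zeroˡ ⟦ Q? ⟧)

⟦⟧-idem : ∀ {a} {P : Set a} (P? : Dec P) → ⟦ P? ⟧ ℤ.* ⟦ P? ⟧ ≡ ⟦ P? ⟧
⟦⟧-idem (yes _) = refl
⟦⟧-idem (no _)  = refl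

∑< : ℕ → (ℕ → ℤ) → ℤ
∑< zero    g = 0ℤ
∑< (suc n) g = g 0 ℤ.+ ∑< n (g ∘ suc)

∑<-cong : ∀ n {g h} → g ≗ h → ∑< n g ≡ ∑< n h
∑<-cong zero    e = refl
∑<-cong (suc n) e = cong₂ ℤ._+_ (e 0) (∑<-cong n (e ∘ suc))

∑<-0 : ∀ n → ∑< n (λ _ → 0ℤ) ≡ 0ℤ
∑<-0 zero    = refl
∑<-0 (suc n) = trans (ℤ.+-identityˡ _) (∑<-0 n)

length-filter-applyUpTo : ∀ {X : Set} {P : Pred X 0ℓ} (P? : Decidable P) (h : ℕ → X) n →
  ⁺ length (filter P? (applyUpTo h n)) ≡ ∑< n (λ i → ⟦ P? (h i) ⟧)
length-filter-applyUpTo P? h zero = refl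
length-filter-applyUpTo P? h (suc n) with P? (h 0)
... | yes _ = cong (ℤ._+_ 1ℤ) (length-filter-applyUpTo P? (h ∘ suc) n)
... | no _  = trans (length-filter-applyUpTo P? (h ∘ suc) n) (sym (ℤ.+-identityˡ _))

length-filter-× : ∀ {P : Pred (ℕ × ℕ) 0ℓ} (P? : Decidable P) (h : ℕ → ℕ) k n →
  ⁺ length (filter P? (cartesianProduct (applyUpTo h k) (upTo n))) ≡
  ∑< k (λ i → ∑< n (λ j → ⟦ P? (h i , j) ⟧))
length-filter-× P? h zero n = refl
length-filter-× P? h (suc k) n = begin
  ⁺ length (filter P? (row ++ rest))
    ≡⟨ cong (λ xs → ⁺ length xs) (List.filter-++ P? row rest) ⟩
  ⁺ length (filter P? row ++ filter P? rest)
    ≡⟨ cong ⁺_ (List.length-++ (filter P? row)) ⟩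
  ⁺ length (filter P? row) ℤ.+ ⁺ length (filter P? rest)
    ≡⟨ cong₂ ℤ._+_
         (trans (cong (λ xs → ⁺ length (filter P? xs)) (List.map-upTo (h 0 ,_) n))
                (length-filter-applyUpTo P? (h 0 ,_) n))
         (length-filter-× P? (h ∘ suc) k n) ⟩
  ∑< n (λ j → ⟦ P? (h 0 , j) ⟧) ℤ.+ ∑< k (λ i → ∑< n (λ j → ⟦ P? (h (suc i) , j) ⟧))
    ∎
  where
  open ≡-Reasoning
  row  = map (h 0 ,_) (upTo n)
  rest = cartesianProduct (applyUpTo (h ∘ suc) k) (upTo n)

∑<-δ : ∀ (g : ℕ → ℤ) {k n} → n < k → ∑< k (λ j → g j ℤ.* δ j n) ≡ g n
∑<-δ g {suc k} {zero} _ = trans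
  (cong₂ ℤ._+_ (ℤ.*-identityʳ (g 0)) (trans (∑<-cong k (λ j → ℤ.*-zeroʳ (g (suc j)))) (∑<-0 k)))
  (ℤ.+-identityʳ _)
∑<-δ g {suc k} {suc n} (s≤s n<k) = trans
  (cong₂ ℤ._+_ (ℤ.*-zeroʳ (g 0)) (∑<-δ (g ∘ suc) n<k))
  (ℤ.+-identityˡ _)

-- The two bounds are kept apart because the induction removes one row and one unit of n but leaves
-- the columns alone.
∑∑-δ : ∀ w {k k′ n} → n < k → n < k′ →
  ∑< k (λ i → ∑< k′ (λ j → w i j ℤ.* δ (i + j) n)) ≡ antidiag w n
∑∑-δ w {suc k} {k′} {zero} _ n<k′ = trans
  (cong₂ ℤ._+_ (∑<-δ (w 0) n<k′)
    (trans (∑<-cong k (λ i → trans (∑<-cong k′ (λ j → ℤ.*-zeroʳ (w (suc i) j))) (∑<-0 k′))) (∑<-0 k)))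
  (ℤ.+-identityʳ _)
∑∑-δ w {suc k} {k′} {suc n} (s≤s n<k) n<k′ =
  cong₂ ℤ._+_ (∑<-δ (w 0) n<k′) (∑∑-δ (w ∘ suc) n<k (ℕ.<-trans (ℕ.n<1+n n) n<k′))

δ-refl : ∀ n → δ n n ≡ 1ℤ
δ-refl zero    = refl
δ-refl (suc n) = δ-refl n

δ-≢ : ∀ k n → k ≢ n → δ k n ≡ 0ℤ
δ-≢ zero    zero    k≢n = contradiction refl k≢n
δ-≢ zero    (suc n) k≢n = refl
δ-≢ (suc k) zero    k≢n = refl
δ-≢ (suc k) (suc n) k≢n = δ-≢ k n (k≢n ∘ cong suc)

⟦≟⟧ : ∀ k n → ⟦ k ℕ.≟ n ⟧ ≡ δ k n
⟦≟⟧ k n with k ℕ.≟ n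
... | yes refl = sym (δ-refl n)
... | no k≢n   = sym (δ-≢ k n k≢n)

trichotomy : ∀ i j → ⟦ i ℕ.<? j ⟧ ℤ.+ ⟦ j ℕ.<? i ⟧ ℤ.+ δ i j ≡ 1ℤ
trichotomy i j with ℕ.<-cmp i j
... | tri< a b c rewrite ⟦⟧-yes (i ℕ.<? j) a | ⟦⟧-no (j ℕ.<? i) c | δ-≢ i j b = refl
... | tri> a b c rewrite ⟦⟧-no (i ℕ.<? j) a | ⟦⟧-yes (j ℕ.<? i) c | δ-≢ i j b = refl
... | tri≈ a refl c rewrite ⟦⟧-no (i ℕ.<? i) a | δ-refl i = refl

module _ {S : Pred ℕ 0ℓ} (S? : Decidable S) where

  private
    c : ℕ → ℤ
    c i = ⟦ S? i ⟧

    ordered : ℕ → ℕ → ℤ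
    ordered i j = c i ℤ.* c j ℤ.* ⟦ i ℕ.<? j ⟧

  R-antidiag : ∀ n → ⁺ R S? n ≡ antidiag ordered n
  R-antidiag n = trans
    (length-filter-× (λ ((i , j) : ℕ × ℕ) → S? i ×-dec S? j ×-dec (i ℕ.<? j) ×-dec (i + j ℕ.≟ n)) id (suc n) (suc n))
    (trans (∑<-cong (suc n) (λ i → ∑<-cong (suc n) (λ j → entry i j)))
           (∑∑-δ ordered (ℕ.n<1+n n) (ℕ.n<1+n n)))
    where
    assoc : ∀ a b c d → a ℤ.* (b ℤ.* (c ℤ.* d)) ≡ a ℤ.* b ℤ.* c ℤ.* d
    assoc = solve-∀
    entry : ∀ i j → ⟦ S? i ×-dec S? j ×-dec (i ℕ.<? j) ×-dec (i + j ℕ.≟ n) ⟧ ≡ ordered i j ℤ.* δ (i + j) n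
    entry i j rewrite ⟦⟧-× (S? i) (S? j ×-dec (i ℕ.<? j) ×-dec (i + j ℕ.≟ n))
      | ⟦⟧-× (S? j) ((i ℕ.<? j) ×-dec (i + j ℕ.≟ n))
      | ⟦⟧-× (i ℕ.<? j) (i + j ℕ.≟ n)
      | ⟦≟⟧ (i + j) n = assoc (c i) (c j) ⟦ i ℕ.<? j ⟧ (δ (i + j) n)

  -- Trichotomy splits the ordered pairs: i < j and j < i give R each by symmetry, and the diagonal
  -- gives c(x²) since an indicator equals its square.
  ⊛-self : ∀ n → (c ⊛ c) n ≡ ⁺ R S? n ℤ.+ ⁺ R S? n ℤ.+ dilate c n
  ⊛-self n = begin
    (c ⊛ c) n
      ≡⟨ antidiag-cong split n ⟩
    antidiag (λ i j → ordered i j ℤ.+ ordered j i ℤ.+ c i ℤ.* δ i j) n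
      ≡⟨ antidiag-+ (λ i j → ordered i j ℤ.+ ordered j i) (λ i j → c i ℤ.* δ i j) n ⟩
    antidiag (λ i j → ordered i j ℤ.+ ordered j i) n ℤ.+ antidiag (λ i j → c i ℤ.* δ i j) n
      ≡⟨ cong₂ ℤ._+_ (antidiag-+ ordered (flip ordered) n) (antidiag-δ c n) ⟩
    antidiag ordered n ℤ.+ antidiag (flip ordered) n ℤ.+ dilate c n
      ≡⟨ cong (λ x → antidiag ordered n ℤ.+ x ℤ.+ dilate c n) (antidiag-flip ordered n) ⟩
    antidiag ordered n ℤ.+ antidiag ordered n ℤ.+ dilate c n
      ≡⟨ cong (λ x → x ℤ.+ x ℤ.+ dilate c n) (R-antidiag n) ⟨
    ⁺ R S? n ℤ.+ ⁺ R S? n ℤ.+ dilate c n ∎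
    where
    open ≡-Reasoning
    diagonal : ∀ i j → c i ℤ.* δ i j ≡ c i ℤ.* c j ℤ.* δ i j
    diagonal i j with i ℕ.≟ j
    ... | yes refl = cong (ℤ._* δ i i) (sym (⟦⟧-idem (S? i)))
    ... | no i≢j rewrite δ-≢ i j i≢j = trans (ℤ.*-zeroʳ (c i)) (sym (ℤ.*-zeroʳ (c i ℤ.* c j)))
    distrib : ∀ a b x y z → a ℤ.* b ℤ.* (x ℤ.+ y ℤ.+ z) ≡ a ℤ.* b ℤ.* x ℤ.+ b ℤ.* a ℤ.* y ℤ.+ a ℤ.* b ℤ.* z
    distrib = solve-∀
    split : ∀ i j → c i ℤ.* c j ≡ ordered i j ℤ.+ ordered j i ℤ.+ c i ℤ.* δ i j
    split i j = begin
      c i ℤ.* c j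
        ≡⟨ ℤ.*-identityʳ (c i ℤ.* c j) ⟨
      c i ℤ.* c j ℤ.* 1ℤ
        ≡⟨ cong (λ x → c i ℤ.* c j ℤ.* x) (trichotomy i j) ⟨
      c i ℤ.* c j ℤ.* (⟦ i ℕ.<? j ⟧ ℤ.+ ⟦ j ℕ.<? i ⟧ ℤ.+ δ i j)
        ≡⟨ distrib (c i) (c j) ⟦ i ℕ.<? j ⟧ ⟦ j ℕ.<? i ⟧ (δ i j) ⟩
      ordered i j ℤ.+ ordered j i ℤ.+ c i ℤ.* c j ℤ.* δ i j
        ≡⟨ cong (λ x → ordered i j ℤ.+ ordered j i ℤ.+ x) (diagonal i j) ⟨
      ordered i j ℤ.+ ordered j i ℤ.+ c i ℤ.* δ i j ∎

-- The product (C + D)(C - D) and its multiplication by 1 - x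

dilate-- : ∀ f g n → dilate (λ i → f i - g i) n ≡ dilate f n - dilate g n
dilate-- f g zero          = refl
dilate-- f g (suc zero)    = refl
dilate-- f g (suc (suc n)) = dilate-- (f ∘ suc) (g ∘ suc) n

difference-of-squares : ∀ c d n →
  ((λ i → c i ℤ.+ d i) ⊛ (λ i → c i - d i)) n ≡ (c ⊛ c) n - (d ⊛ d) n
difference-of-squares c d n = begin
  ((λ i → c i ℤ.+ d i) ⊛ (λ i → c i - d i)) n
    ≡⟨ antidiag-cong (λ i j → expand (c i) (d i) (c j) (d j)) n ⟩
  antidiag (λ i j → (c i ℤ.* c j - d i ℤ.* d j) ℤ.+ (d i ℤ.* c j - c i ℤ.* d j)) n
    ≡⟨ antidiag-+ (λ i j → c i ℤ.* c j - d i ℤ.* d j) (λ i j → d i ℤ.* c j - c i ℤ.* d j) n ⟩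
  antidiag (λ i j → c i ℤ.* c j - d i ℤ.* d j) n ℤ.+ antidiag (λ i j → d i ℤ.* c j - c i ℤ.* d j) n
    ≡⟨ cong₂ ℤ._+_ (antidiag-- (λ i j → c i ℤ.* c j) (λ i j → d i ℤ.* d j) n) cancel ⟩
  (c ⊛ c) n - (d ⊛ d) n ℤ.+ 0ℤ
    ≡⟨ ℤ.+-identityʳ _ ⟩
  (c ⊛ c) n - (d ⊛ d) n ∎
  where
  open ≡-Reasoning
  expand : ∀ a b x y → (a ℤ.+ b) ℤ.* (x - y) ≡ (a ℤ.* x - b ℤ.* y) ℤ.+ (b ℤ.* x - a ℤ.* y)
  expand = solve-∀
  ⊛-comm : (d ⊛ c) n ≡ (c ⊛ d) n
  ⊛-comm = trans (sym (antidiag-flip (λ i j → d i ℤ.* c j) n)) (antidiag-cong (λ i j → ℤ.*-comm (d j) (c i)) n)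
  cancel : antidiag (λ i j → d i ℤ.* c j - c i ℤ.* d j) n ≡ 0ℤ
  cancel = trans (antidiag-- (λ i j → d i ℤ.* c j) (λ i j → c i ℤ.* d j) n) (ℤ.i≡j⇒i-j≡0 ⊛-comm)

-- The polynomial 1 + x + ⋯ + xᵐ, whose product with 1 - x telescopes to two monomials.
below : ℕ → ℕ → ℤ
below m       zero    = 1ℤ
below zero    (suc n) = 0ℤ
below (suc m) (suc n) = below m n

below-≤ : ∀ {m n} → n ≤ m → below m n ≡ 1ℤ
below-≤ z≤n       = refl
below-≤ (s≤s n≤m) = below-≤ n≤m

below-> : ∀ {m n} → m < n → below m n ≡ 0ℤ
below-> {zero}  (s≤s _)   = refl
below-> {suc m} (s≤s m<n) = below-> m<n

Δ-below : ∀ m n → Δ (below m) n ≡ δ 0 n - δ (suc m) n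
Δ-below m       zero          = refl
Δ-below zero    (suc zero)    = refl
Δ-below zero    (suc (suc n)) = refl
Δ-below (suc m) (suc zero)    = refl
Δ-below (suc m) (suc (suc n)) = Δ-below m (suc n)

Δ-δ : ∀ r n → Δ (δ r) n ≡ δ r n - δ (suc r) n
Δ-δ r       zero          = sym (ℤ.+-identityʳ _)
Δ-δ zero    (suc zero)    = refl
Δ-δ zero    (suc (suc n)) = refl
Δ-δ (suc r) (suc zero)    = refl
Δ-δ (suc r) (suc (suc n)) = Δ-δ r (suc n)

-- The n-th coefficient of (1 − x) u(x) f(x), where u(x) = 1 + x + ⋯ + xᵐ + xʳ.
masked : ℕ → ℕ → (ℕ → ℤ) → ℕ → ℤ
masked m r f n = f n ℤ.+ shift r f n - shift (suc r) f n - shift (suc m) f n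

Δ-⊛-masked : ∀ m r {u} f → u ≗ (λ n → below m n ℤ.+ δ r n) → Δ (u ⊛ f) ≗ masked m r f
Δ-⊛-masked m r {u} f u≗ n = begin
  Δ (u ⊛ f) n
    ≡⟨ Δ-⊛ u f n ⟩
  (Δ u ⊛ f) n
    ≡⟨ antidiag-cong (λ i j → cong (ℤ._* f j) (Δu i)) n ⟩
  antidiag (λ i j → (δ 0 i ℤ.+ δ r i - δ (suc r) i - δ (suc m) i) ℤ.* f j) n
    ≡⟨ antidiag-cong (λ i j → distrib (δ 0 i) (δ r i) (δ (suc r) i) (δ (suc m) i) (f j)) n ⟩
  antidiag (λ i j → w 0 i j ℤ.+ w r i j - w (suc r) i j - w (suc m) i j) n
    ≡⟨ antidiag-- (λ i j → w 0 i j ℤ.+ w r i j - w (suc r) i j) (w (suc m)) n ⟩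
  antidiag (λ i j → w 0 i j ℤ.+ w r i j - w (suc r) i j) n - (δ (suc m) ⊛ f) n
    ≡⟨ cong (_- (δ (suc m) ⊛ f) n) (antidiag-- (λ i j → w 0 i j ℤ.+ w r i j) (w (suc r)) n) ⟩
  antidiag (λ i j → w 0 i j ℤ.+ w r i j) n - (δ (suc r) ⊛ f) n - (δ (suc m) ⊛ f) n
    ≡⟨ cong (λ x → x - (δ (suc r) ⊛ f) n - (δ (suc m) ⊛ f) n) (antidiag-+ (w 0) (w r) n) ⟩
  (δ 0 ⊛ f) n ℤ.+ (δ r ⊛ f) n - (δ (suc r) ⊛ f) n - (δ (suc m) ⊛ f) n
    ≡⟨ cong₂ _-_ (cong₂ _-_ (cong₂ ℤ._+_ (δ-⊛ 0 f n) (δ-⊛ r f n)) (δ-⊛ (suc r) f n)) (δ-⊛ (suc m) f n) ⟩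
  masked m r f n ∎
  where
  open ≡-Reasoning
  w : ℕ → ℕ → ℕ → ℤ
  w k i j = δ k i ℤ.* f j
  distrib : ∀ a b c d x → (a ℤ.+ b - c - d) ℤ.* x ≡ a ℤ.* x ℤ.+ b ℤ.* x - c ℤ.* x - d ℤ.* x
  distrib = solve-∀
  Δ-+ : ∀ g h n → Δ (λ i → g i ℤ.+ h i) n ≡ Δ g n ℤ.+ Δ h n
  Δ-+ g h zero    = refl
  Δ-+ g h (suc n) = interchange (g (suc n)) (h (suc n)) (g n) (h n)
    where
    interchange : ∀ a b c d → (a ℤ.+ b) - (c ℤ.+ d) ≡ (a - c) ℤ.+ (b - d)
    interchange = solve-∀
  reorder : ∀ a b c d → (a - d) ℤ.+ (b - c) ≡ a ℤ.+ b - c - d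
  reorder = solve-∀
  Δu : ∀ i → Δ u i ≡ δ 0 i ℤ.+ δ r i - δ (suc r) i - δ (suc m) i
  Δu i = begin
    Δ u i                                                    ≡⟨ Δ-cong u≗ i ⟩
    Δ (λ n → below m n ℤ.+ δ r n) i                          ≡⟨ Δ-+ (below m) (δ r) i ⟩
    Δ (below m) i ℤ.+ Δ (δ r) i                              ≡⟨ cong₂ ℤ._+_ (Δ-below m i) (Δ-δ r i) ⟩
    (δ 0 i - δ (suc m) i) ℤ.+ (δ r i - δ (suc r) i)          ≡⟨ reorder (δ 0 i) (δ r i) (δ (suc r) i) (δ (suc m) i) ⟩
    δ 0 i ℤ.+ δ r i - δ (suc r) i - δ (suc m) i              ∎

-- The Thue–Morse sequence

ones : Expansion 2 → ℕ
ones ds = length (filter (_≟ᶠ 1b) ds)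

-- Lists start with the least significant digit, so two expansions of one number differ only by
-- zeros at the end of the list. Facts about `binaryOnes` then follow by exhibiting any one
-- expansion.
ones-unique : ∀ ds es → fromDigits ds ≡ fromDigits es → ones ds ≡ ones es
ones-unique []              []              _  = refl
ones-unique []              (Fin.zero ∷ es)     eq = ones-unique [] es (ℕ.*-cancelʳ-≡ 0 _ 2 eq)
ones-unique (Fin.zero ∷ ds)     []              eq = ones-unique ds [] (ℕ.*-cancelʳ-≡ _ 0 2 eq)
ones-unique (Fin.zero ∷ ds)     (Fin.zero ∷ es)     eq = ones-unique ds es (ℕ.*-cancelʳ-≡ _ _ 2 eq)
ones-unique (Fin.suc Fin.zero ∷ ds) (Fin.suc Fin.zero ∷ es) eq = cong suc (ones-unique ds es (ℕ.*-cancelʳ-≡ _ _ 2 (ℕ.suc-injective eq)))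
ones-unique (Fin.zero ∷ ds)     (Fin.suc Fin.zero ∷ es) eq = contradiction
  (trans (ℕ.*-comm 2 (fromDigits ds)) (trans eq (cong suc (ℕ.*-comm (fromDigits es) 2))))
  (ℕ.even≢odd (fromDigits ds) (fromDigits es))
ones-unique (Fin.suc Fin.zero ∷ ds) (Fin.zero ∷ es)     eq = contradiction
  (trans (ℕ.*-comm 2 (fromDigits es)) (trans (sym eq) (cong suc (ℕ.*-comm (fromDigits ds) 2))))
  (ℕ.even≢odd (fromDigits es) (fromDigits ds))

binaryOnes-even : ∀ n → binaryOnes (2 * n) ≡ binaryOnes n
binaryOnes-even n with toDigits 2 (2 * n) | toDigits 2 n
... | ds , ds≡ | es , es≡ = ones-unique ds (0b ∷ es)
  (trans ds≡ (trans (ℕ.*-comm 2 n) (cong (_* 2) (sym es≡))))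

binaryOnes-odd : ∀ n → binaryOnes (suc (2 * n)) ≡ suc (binaryOnes n)
binaryOnes-odd n with toDigits 2 (suc (2 * n)) | toDigits 2 n
... | ds , ds≡ | es , es≡ = ones-unique ds (1b ∷ es)
  (trans ds≡ (cong suc (trans (ℕ.*-comm 2 n) (cong (_* 2) (sym es≡)))))

-- Opacity keeps `toDigits` from being unfolded; all later arguments go through the digit rules
-- derived from `t-def`.
opaque
  t : ℕ → ℤ
  t n = -1ℤ ℤ.^ binaryOnes n

  t-def : ∀ n → t n ≡ -1ℤ ℤ.^ binaryOnes n
  t-def n = refl

-- Indexing by the integer itself lets a case split turn an equation between unknown signs into a
-- closed one, settled by computation.
data Sign : ℤ → Set where
  pos : Sign 1ℤ
  neg : Sign -1ℤ

data Trit : ℤ → Set where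
  pos  : Trit 1ℤ
  zero : Trit 0ℤ
  neg  : Trit -1ℤ

Sign-neg : ∀ {x} → Sign x → Sign (- x)
Sign-neg pos = neg
Sign-neg neg = pos

x≢-x : ∀ {x} → Sign x → x ≢ - x
x≢-x pos ()
x≢-x neg ()

Sign-^ : ∀ k → Sign (-1ℤ ℤ.^ k)
Sign-^ zero    = pos
Sign-^ (suc k) = subst Sign (sym (ℤ.-1*i≡-i _)) (Sign-neg (Sign-^ k))

t-sign : ∀ n → Sign (t n)
t-sign n = subst Sign (sym (t-def n)) (Sign-^ (binaryOnes n))

t-even : ∀ n → t (2 * n) ≡ t n
t-even n = begin
  t (2 * n)                      ≡⟨ t-def (2 * n) ⟩
  -1ℤ ℤ.^ binaryOnes (2 * n)     ≡⟨ cong (-1ℤ ℤ.^_) (binaryOnes-even n) ⟩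
  -1ℤ ℤ.^ binaryOnes n           ≡⟨ t-def n ⟨
  t n                            ∎
  where open ≡-Reasoning

t-odd : ∀ n → t (suc (2 * n)) ≡ - t n
t-odd n = begin
  t (suc (2 * n))                     ≡⟨ t-def (suc (2 * n)) ⟩
  -1ℤ ℤ.^ binaryOnes (suc (2 * n))    ≡⟨ cong (-1ℤ ℤ.^_) (binaryOnes-odd n) ⟩
  -1ℤ ℤ.* (-1ℤ ℤ.^ binaryOnes n)      ≡⟨ ℤ.-1*i≡-i _ ⟩
  - (-1ℤ ℤ.^ binaryOnes n)            ≡⟨ cong -_ (t-def n) ⟨
  - t n                               ∎
  where open ≡-Reasoning

t-odd-even : ∀ n → t (suc (2 * n)) ≡ - t (2 * n)
t-odd-even n = trans (t-odd n) (cong -_ (sym (t-even n)))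

t-odd≢even : ∀ n → t (suc (2 * n)) ≢ t (2 * n)
t-odd≢even n eq = x≢-x (t-sign (2 * n)) (trans (sym eq) (t-odd-even n))

t0 : t 0 ≡ 1ℤ
t0 = t-def 0

t1 : t 1 ≡ -1ℤ
t1 = t-def 1

t2 : t 2 ≡ -1ℤ
t2 = t-def 2

-1^even : ∀ k → -1ℤ ℤ.^ (2 * k) ≡ 1ℤ
-1^even k = trans (sym (ℤ.^-*-assoc -1ℤ 2 k)) (ℤ.^-zeroˡ k)

-1^odd : ∀ k → -1ℤ ℤ.^ suc (2 * k) ≡ -1ℤ
-1^odd k = cong (-1ℤ ℤ.*_) (-1^even k)

-1^≡1⇒2∣ : ∀ k → -1ℤ ℤ.^ k ≡ 1ℤ → 2 ∣ k
-1^≡1⇒2∣ k eq with half k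
... | even a = m∣m*n a
... | odd a  = contradiction (trans (sym eq) (-1^odd a)) λ ()

A⇒t : ∀ n → A n → t n ≡ 1ℤ
A⇒t n (divides q eq) = trans (t-def n) (trans (cong (-1ℤ ℤ.^_) (trans eq (ℕ.*-comm q 2))) (-1^even q))

t⇒A : ∀ n → t n ≡ 1ℤ → A n
t⇒A n tn = -1^≡1⇒2∣ (binaryOnes n) (trans (sym (t-def n)) tn)

t⇒B : ∀ n → t n ≡ -1ℤ → B n
t⇒B n tn a = contradiction (trans (sym tn) (A⇒t n a)) λ ()

B⇒t : ∀ n → B n → t n ≡ -1ℤ
B⇒t n b with t n in eq | t-sign n
... | _ | pos = contradiction (t⇒A n eq) b
... | _ | neg = refl

-- The two digit rules in series form, t(x) = (1 - x) t(x²): the recurrence for f without its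
-- shifted terms.
t-Δdilate : ∀ n → Δ (dilate t) n ≡ t n
t-Δdilate n with half n
... | even k = trans (Δdilate-even t k refl) (sym (t-even k))
... | odd k  = trans (Δdilate-odd t k refl) (sym (t-odd k))

t-2^+ : ∀ i {j} → j < 2 ^ i → t (2 ^ i + j) ≡ - t j
t-2^+ zero    {zero} _ = trans t1 (cong -_ (sym t0))
t-2^+ zero    {suc j} (s≤s ())
t-2^+ (suc i) {j} j<  with half j
... | even k = begin
  t (2 * 2 ^ i + 2 * k)   ≡⟨ cong t (ℕ.*-distribˡ-+ 2 (2 ^ i) k) ⟨
  t (2 * (2 ^ i + k))     ≡⟨ t-even (2 ^ i + k) ⟩
  t (2 ^ i + k)           ≡⟨ t-2^+ i (ℕ.*-cancelˡ-< 2 k (2 ^ i) j<) ⟩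
  - t k                   ≡⟨ cong -_ (t-even k) ⟨
  - t (2 * k)             ∎
  where open ≡-Reasoning
... | odd k = begin
  t (2 * 2 ^ i + suc (2 * k)) ≡⟨ cong t (ℕ.+-suc (2 * 2 ^ i) (2 * k)) ⟩
  t (suc (2 * 2 ^ i + 2 * k)) ≡⟨ cong (t ∘ suc) (ℕ.*-distribˡ-+ 2 (2 ^ i) k) ⟨
  t (suc (2 * (2 ^ i + k)))   ≡⟨ t-odd (2 ^ i + k) ⟩
  - t (2 ^ i + k)             ≡⟨ cong -_ (t-2^+ i (ℕ.*-cancelˡ-< 2 k (2 ^ i) (ℕ.<-trans (ℕ.n<1+n _) j<))) ⟩
  - - t k                     ≡⟨ cong -_ (t-odd k) ⟨
  - t (suc (2 * k))           ∎
  where open ≡-Reasoning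

t-2^ : ∀ i → t (2 ^ i) ≡ -1ℤ
t-2^ i = trans (cong t (sym (ℕ.+-identityʳ (2 ^ i)))) (trans (t-2^+ i (ℕ.m^n>0 2 i)) (cong -_ t0))

-- The number 2ᵏ - 1 is written with k ones. This links the sign of t r to the parity of the
-- exponent, hence to powers of four.
t-pred-2^ : ∀ k {n} → suc n ≡ 2 ^ k → t n ≡ -1ℤ ℤ.^ k
t-pred-2^ zero    refl = t0
t-pred-2^ (suc k) {n} eq with half n
... | even a = contradiction (sym eq) (ℕ.even≢odd (2 ^ k) a)
... | odd a  = begin
  t (suc (2 * a))       ≡⟨ t-odd a ⟩
  - t a                 ≡⟨ cong -_ (t-pred-2^ k (ℕ.*-cancelˡ-≡ (suc a) (2 ^ k) 2 (trans (ℕ.*-suc 2 a) eq))) ⟩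
  - (-1ℤ ℤ.^ k)         ≡⟨ ℤ.-1*i≡-i _ ⟨
  -1ℤ ℤ.* (-1ℤ ℤ.^ k)   ∎
  where open ≡-Reasoning

-- A shift by an odd number would move the equality t 1 = t 2 to positions 2k, 2k + 1, where t changes sign.
odd-shift-impossible : ∀ σ a → t (suc (2 * a) + 1) ≡ σ ℤ.* t 1 → t (suc (2 * a) + 2) ≡ σ ℤ.* t 2 → ⊥
odd-shift-impossible σ a e₁ e₂ = t-odd≢even (suc a) (begin
  t (suc (2 * suc a))       ≡⟨ cong t (index₂ a) ⟨
  t (suc (2 * a) + 2)       ≡⟨ e₂ ⟩
  σ ℤ.* t 2                 ≡⟨ cong (σ ℤ.*_) (trans t1 (sym t2)) ⟨
  σ ℤ.* t 1                 ≡⟨ e₁ ⟨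
  t (suc (2 * a) + 1)       ≡⟨ cong t (index₁ a) ⟩
  t (2 * suc a)             ∎)
  where
  open ≡-Reasoning
  index₁ : ∀ a → suc (2 * a) + 1 ≡ 2 * suc a
  index₁ = ℕ-Solver.solve-∀
  index₂ : ∀ a → suc (2 * a) + 2 ≡ suc (2 * suc a)
  index₂ = ℕ-Solver.solve-∀

t-halve : ∀ σ q j → t (2 * q + 2 * j) ≡ σ ℤ.* t (2 * j) → t (q + j) ≡ σ ℤ.* t j
t-halve σ q j e = begin
  t (q + j)          ≡⟨ t-even (q + j) ⟨
  t (2 * (q + j))    ≡⟨ cong t (ℕ.*-distribˡ-+ 2 q j) ⟩
  t (2 * q + 2 * j)  ≡⟨ e ⟩
  σ ℤ.* t (2 * j)    ≡⟨ cong (σ ℤ.*_) (t-even j) ⟩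
  σ ℤ.* t j          ∎
  where open ≡-Reasoning

t-halve-unsigned : ∀ q j → t (2 * q + 2 * j) ≡ t (2 * j) → t (q + j) ≡ t j
t-halve-unsigned q j e = trans (t-halve 1ℤ q j (trans e (sym (ℤ.*-identityˡ _)))) (ℤ.*-identityˡ _)

-- Descent on q: an even q is halved using the even positions j, and an odd q ≥ 3 is an odd shift
-- that covers j = 1 and j = 2. The sign σ is 1 when r is even and -1 when r is odd.
shifted-block⇒2^ : ∀ {σ} q → 0 < q → (∀ j → j < q → t (q + j) ≡ σ ℤ.* t j) → ∃[ i ] q ≡ 2 ^ i
shifted-block⇒2^ {σ} q = go q (<-wellFounded q)
  where
  go : ∀ q → Acc _<_ q → 0 < q → (∀ j → j < q → t (q + j) ≡ σ ℤ.* t j) → ∃[ i ] q ≡ 2 ^ i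
  go q a 0<q e with half q
  go _ (acc rec) 0<q e | even k@(suc k′) with go k (rec (ℕ.m<m+n k z<s)) z<s
    (λ j j<k → t-halve σ k j (e (2 * j) (ℕ.*-monoʳ-< 2 j<k)))
  ... | i , k≡ = suc i , cong (2 *_) k≡
  go _ _ () e | even zero
  go _ _ _ e | odd zero = 0 , refl
  go _ _ _ e | odd (suc a) = contradiction (e 2 (s≤s 2≤)) (λ e₂ → odd-shift-impossible σ (suc a) (e 1 (s≤s (ℕ.≤-trans (s≤s z≤n) 2≤))) e₂)
    where
    2≤ : 2 ≤ 2 * suc a
    2≤ = ℕ.*-monoʳ-≤ 2 (s≤s z≤n)

-- For i > 0 the parities of p and q agree. If both are even, everything halves. If both are odd,
-- then q = 1 would give t 1 = t 0, and q ≥ 3 makes p an odd shift that covers j = 1 and j = 2.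
complementary-shifts-impossible : ∀ i p q → 0 < p → 0 < q → p + q ≡ 2 ^ i →
  (∀ j → j < p → t (q + j) ≡ t j) → (∀ j → j < q → t (p + j) ≡ t j) → ⊥
complementary-shifts-impossible zero (suc p) (suc q) _ _ eq _ _ =
  contradiction (trans (sym (ℕ.+-suc p q)) (ℕ.suc-injective eq)) λ ()
complementary-shifts-impossible (suc i) p q 0<p 0<q eq ep eq′ with half p | half q
... | even a | even b = complementary-shifts-impossible i a b
  (ℕ.*-cancelˡ-< 2 0 a 0<p) (ℕ.*-cancelˡ-< 2 0 b 0<q)
  (ℕ.*-cancelˡ-≡ _ _ 2 (trans (ℕ.*-distribˡ-+ 2 a b) eq))
  (λ j j<a → t-halve-unsigned b j (ep (2 * j) (ℕ.*-monoʳ-< 2 j<a)))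
  (λ j j<b → t-halve-unsigned a j (eq′ (2 * j) (ℕ.*-monoʳ-< 2 j<b)))
... | even a | odd b = ℕ.even≢odd (2 ^ i) (a + b)
  (trans (sym eq) (trans (ℕ.+-suc (2 * a) (2 * b)) (cong suc (sym (ℕ.*-distribˡ-+ 2 a b)))))
... | odd a | even b = ℕ.even≢odd (2 ^ i) (a + b) (trans (sym eq) (cong suc (sym (ℕ.*-distribˡ-+ 2 a b))))
... | odd a | odd zero = contradiction (trans (sym t1) (trans (ep 0 z<s) t0)) λ ()
... | odd a | odd (suc b) = odd-shift-impossible 1ℤ a (trans (eq′ 1 (s≤s (ℕ.≤-trans (s≤s z≤n) 2≤))) (sym (ℤ.*-identityˡ _)))
    (trans (eq′ 2 (s≤s 2≤)) (sym (ℤ.*-identityˡ _)))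
    where
    2≤ : 2 ≤ 2 * suc b
    2≤ = ℕ.*-monoʳ-≤ 2 (s≤s z≤n)

-- Solving the recurrence

-- The glued Thue-Morse pattern expressed through f alone, where both directions of the theorem
-- meet. Index r is left out: both sets contain it, so f vanishes there.
record Shape (m r : ℕ) (f : ℕ → ℤ) : Set where
  field
    l     : ℕ
    suc-r : suc r ≡ 2 ^ (2 * l)
    m≡2r  : m ≡ 2 * r
    lower : ∀ n → n < r → f n ≡ t n
    upper : ∀ j → 0 < j → j ≤ r → f (r + j) ≡ - t j

shift-Trit : ∀ {f} → (∀ n → Trit (f n)) → ∀ k n → Trit (shift k f n)
shift-Trit trit zero    n       = trit n
shift-Trit trit (suc k) zero    = zero
shift-Trit trit (suc k) (suc n) = shift-Trit trit k n

module Solution {m r : ℕ} {f : ℕ → ℤ} (r≤m : r ≤ m)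
  (trit : ∀ n → Trit (f n)) (f-r : f r ≡ 0ℤ) (f-beyond : ∀ {n} → m < n → f n ≡ 0ℤ)
  (eqn : masked m r f ≗ Δ (dilate f)) where

  -- The recurrence solved for f n. Known terms are supplied as equations, and a term still unknown
  -- is kept by `refl`.
  step : ∀ n {a b c d} → Δ (dilate f) n ≡ a → shift r f n ≡ b → shift (suc r) f n ≡ c → shift (suc m) f n ≡ d →
    f n ≡ a - b ℤ.+ c ℤ.+ d
  step n refl refl refl refl = trans (isolate (f n) (shift r f n) (shift (suc r) f n) (shift (suc m) f n))
    (cong (λ x → x - shift r f n ℤ.+ shift (suc r) f n ℤ.+ shift (suc m) f n) (eqn n))
    where
    isolate : ∀ x b c d → x ≡ (x ℤ.+ b - c - d) - b ℤ.+ c ℤ.+ d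
    isolate = solve-∀

  -- For r = 0 the value f n occurs twice in the recurrence. If m > 0, index 1 then gives f 1 = - f
  -- 1, impossible for a sign, so m = 0.
  r≡0⇒shape : r ≡ 0 → (1 ≤ m → Sign (f 1)) → Shape m r f
  r≡0⇒shape refl f-1 = record
    { l     = 0
    ; suc-r = refl
    ; m≡2r  = ℕ.n≤0⇒n≡0 (ℕ.≮⇒≥ m≯0)
    ; lower = λ _ ()
    ; upper = λ { _ 0<j z≤n → contradiction 0<j λ () }
    }
    where
    clash : ∀ {x} → Sign x → x ≢ 0ℤ - x ℤ.+ 0ℤ ℤ.+ 0ℤ
    clash pos ()
    clash neg ()
    m≯0 : ¬ 0 < m
    m≯0 0<m = clash (f-1 0<m)
      (step 1 (trans (Δdilate-odd f 0 refl) (cong -_ f-r)) refl f-r (shift-< (s≤s 0<m)))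

  module _ (0<r : 0 < r) (f-0 : f 0 ≡ 1ℤ) where

    low : ∀ n → n < r → f n ≡ t n
    low = <-rec _ go
      where
      tidy : ∀ x → x - 0ℤ ℤ.+ 0ℤ ℤ.+ 0ℤ ≡ x
      tidy = solve-∀
      go : ∀ n → (∀ {k} → k < n → k < r → f k ≡ t k) → n < r → f n ≡ t n
      go n rec n<r = trans
        (step n (trans (Δdilate-cong n earlier) (t-Δdilate n))
          (shift-< n<r) (shift-< (ℕ.m<n⇒m<1+n n<r)) (shift-< (s≤s (ℕ.≤-trans (ℕ.<⇒≤ n<r) r≤m))))
        (tidy (t n))
        where
        earlier : ∀ k → 2 * k ≤ n → f k ≡ t k
        -- The index 0 is not smaller than n when n = 0, so it rests on the initial value and not on
        -- the recursion.
        earlier zero      _  = trans f-0 (sym t0)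
        earlier k@(suc _) le = rec k<n (ℕ.<-trans k<n n<r)
          where
          k<n : k < n
          k<n = ℕ.<-≤-trans (ℕ.m<m+n k z<s) le

    Δdilate-low : ∀ {n} → n < 2 * r → Δ (dilate f) n ≡ t n
    Δdilate-low {n} n<2r = trans
      (Δdilate-cong n (λ k le → low k (ℕ.*-cancelˡ-< 2 k r (ℕ.≤-<-trans le n<2r))))
      (t-Δdilate n)

    r+r≡2r : r + r ≡ 2 * r
    r+r≡2r = cong (r +_) (sym (ℕ.+-identityʳ r))

    r+<2r : ∀ {j} → j < r → r + j < 2 * r
    r+<2r {j} j<r = subst (r + j <_) r+r≡2r (ℕ.+-monoʳ-< r j<r)

    -- At index r the only shifted term is f 0 = 1, and it has to cancel t r because f r = 0.
    t-r : t r ≡ 1ℤ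
    t-r = solveSign (t-sign r) (trans (sym f-r) (step r
      (Δdilate-low (subst (_< 2 * r) (ℕ.+-identityʳ r) (r+<2r 0<r)))
      (trans (shift-at r (sym (ℕ.+-identityʳ r))) f-0)
      (shift-< (ℕ.n<1+n r)) (shift-< (s≤s r≤m))))
      where
      solveSign : ∀ {x} → Sign x → 0ℤ ≡ x - 1ℤ ℤ.+ 0ℤ ℤ.+ 0ℤ → x ≡ 1ℤ
      solveSign pos _ = refl
      solveSign neg ()

    echo : ∀ j → suc (2 * j) < r → t (suc (r + 2 * j)) ≡ - t j
    echo j j<r = go (n ℕ.≤? m)
      where
      n : ℕ
      n = suc (r + 2 * j)
      eq : f n ≡ t n - (- t j) ℤ.+ t j ℤ.+ shift (suc m) f n
      eq = step n (Δdilate-low (subst (_< 2 * r) (ℕ.+-suc r (2 * j)) (r+<2r j<r)))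
        (trans (shift-at r (sym (ℕ.+-suc r (2 * j)))) (trans (low _ j<r) (t-odd j)))
        (trans (shift-at (suc r) refl) (trans (low _ (ℕ.<-trans (ℕ.n<1+n _) j<r)) (t-even j)))
        refl
      inside : ∀ {a b x} → Sign a → Sign b → Trit x → x ≡ b - (- a) ℤ.+ a ℤ.+ 0ℤ → b ≡ - a
      inside pos neg _ _ = refl
      inside neg pos _ _ = refl
      inside pos pos () refl
      inside neg neg () refl
      outside : ∀ {a b x} → Sign a → Sign b → Trit x → 0ℤ ≡ b - (- a) ℤ.+ a ℤ.+ x → b ≡ - a
      outside pos neg _ _ = refl
      outside neg pos _ _ = refl
      outside pos pos pos ()
      outside pos pos zero ()
      outside pos pos neg ()
      outside neg neg pos ()
      outside neg neg zero ()
      outside neg neg neg ()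
      go : Dec (n ≤ m) → t n ≡ - t j
      go (yes n≤m) = inside (t-sign j) (t-sign n) (trit n)
        (trans eq (cong (λ x → t n - (- t j) ℤ.+ t j ℤ.+ x) (shift-< (s≤s n≤m))))
      go (no n≰m)  = outside (t-sign j) (t-sign n) (shift-Trit trit (suc m) n)
        (trans (sym (f-beyond (ℕ.≰⇒> n≰m))) eq)

    -- For r = 2s, `echo` becomes t (s + j) = t j for j < s. Hence s and r are powers of two, where
    -- t is -1, against `t-r`.
    r-not-even : ∀ s → r ≢ 2 * s
    r-not-even s r≡ with shifted-block⇒2^ {1ℤ} s 0<s block
      where
      0<s : 0 < s
      0<s = ℕ.*-cancelˡ-< 2 0 s (subst (0 <_) r≡ 0<r)
      block : ∀ j → j < s → t (s + j) ≡ 1ℤ ℤ.* t j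
      block j j<s = trans (ℤ.neg-injective (begin
        - t (s + j)               ≡⟨ t-odd (s + j) ⟨
        t (suc (2 * (s + j)))     ≡⟨ cong (t ∘ suc) (ℕ.*-distribˡ-+ 2 s j) ⟩
        t (suc (2 * s + 2 * j))   ≡⟨ cong (λ x → t (suc (x + 2 * j))) r≡ ⟨
        t (suc (r + 2 * j))       ≡⟨ echo j (subst (suc (2 * j) <_) (sym r≡) (subst (_≤ 2 * s) (ℕ.*-suc 2 j) (ℕ.*-monoʳ-≤ 2 j<s))) ⟩
        - t j                     ∎)) (sym (ℤ.*-identityˡ (t j)))
        where open ≡-Reasoning
    ... | i , refl = contradiction (trans (sym (t-2^ i)) (trans (sym (t-even (2 ^ i))) (trans (cong t (sym r≡)) t-r))) λ ()

    -- For r = 2s + 1, `echo` becomes t (s + 1 + j) = - t j for j < s, one position short of a full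
    -- block. Halving s + 1 removes this defect, since only even j are kept.
    r-odd : ∀ s → r ≡ suc (2 * s) → ∃[ l ] suc s ≡ 2 ^ suc (2 * l)
    r-odd s r≡ = go (half (suc s)) refl
      where
      t-s : t s ≡ -1ℤ
      t-s = ℤ.neg-injective (trans (sym (t-odd s)) (trans (cong t (sym r≡)) t-r))
      block : ∀ j → j < s → t (suc s + j) ≡ - t j
      block j j<s = begin
        t (suc s + j)                  ≡⟨ t-even (suc s + j) ⟨
        t (2 * (suc s + j))            ≡⟨ cong t (index s j) ⟩
        t (suc (suc (2 * s) + 2 * j))  ≡⟨ cong (λ x → t (suc (x + 2 * j))) r≡ ⟨
        t (suc (r + 2 * j))            ≡⟨ echo j (subst (suc (2 * j) <_) (sym r≡) (s<s (ℕ.*-monoʳ-< 2 j<s))) ⟩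
        - t j                          ∎
        where
        open ≡-Reasoning
        index : ∀ s j → 2 * (suc s + j) ≡ suc (suc (2 * s) + 2 * j)
        index = ℕ-Solver.solve-∀
      go : ∀ {n} → Half n → suc s ≡ n → ∃[ l ] suc s ≡ 2 ^ suc (2 * l)
      -- If s + 1 is odd, the positions s and s + 1 form a pair 2a, 2a + 1, yet t is -1 at both.
      go (odd a) eq = contradiction (begin
        t (suc (2 * a))   ≡⟨ cong t eq ⟨
        t (suc s)         ≡⟨ cong t (ℕ.+-identityʳ (suc s)) ⟨
        t (suc s + 0)     ≡⟨ block 0 0<s ⟩
        - t 0             ≡⟨ cong -_ t0 ⟩
        -1ℤ               ≡⟨ t-s ⟨
        t s               ≡⟨ cong t (ℕ.suc-injective eq) ⟩
        t (2 * a)         ∎) (t-odd≢even a)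
        where
        open ≡-Reasoning
        0<s : 0 < s
        0<s = ℕ.n≢0⇒n>0 λ s≡0 → contradiction (trans (sym t0) (trans (cong t (sym s≡0)) t-s)) λ ()
      go (even q) eq with shifted-block⇒2^ { -1ℤ} q 0<q block′
        where
        0<q : 0 < q
        0<q = ℕ.*-cancelˡ-< 2 0 q (subst (0 <_) eq z<s)
        block′ : ∀ j → j < q → t (q + j) ≡ -1ℤ ℤ.* t j
        block′ j j<q = t-halve -1ℤ q j (begin
          t (2 * q + 2 * j)   ≡⟨ cong (λ x → t (x + 2 * j)) eq ⟨
          t (suc s + 2 * j)   ≡⟨ block (2 * j) (ℕ.≤-pred (subst (suc (suc (2 * j)) ≤_) (sym eq) (subst (_≤ 2 * q) (ℕ.*-suc 2 j) (ℕ.*-monoʳ-≤ 2 j<q)))) ⟩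
          - t (2 * j)         ≡⟨ ℤ.-1*i≡-i _ ⟨
          -1ℤ ℤ.* t (2 * j)   ∎)
          where open ≡-Reasoning
      ... | i , q≡ with half i
      ...   | even l = l , trans eq (cong (2 *_) q≡)
      -- Here r + 1 = 2^(2l + 3), so r has an odd number of ones, against t r = 1.
      ...   | odd l  = contradiction (begin
        1ℤ                                  ≡⟨ t-r ⟨
        t r                                 ≡⟨ t-pred-2^ (suc (suc (suc (2 * l)))) suc-r ⟩
        -1ℤ ℤ.* (-1ℤ ℤ.* (-1ℤ ℤ.^ suc (2 * l))) ≡⟨ cong (λ x → -1ℤ ℤ.* (-1ℤ ℤ.* x)) (-1^odd l) ⟩
        -1ℤ                                 ∎) λ ()
        where
        open ≡-Reasoning
        suc-r : suc r ≡ 2 ^ suc (suc (suc (2 * l)))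
        suc-r = begin
          suc r               ≡⟨ cong suc r≡ ⟩
          suc (suc (2 * s))   ≡⟨ ℕ.*-suc 2 s ⟨
          2 * suc s           ≡⟨ cong (2 *_) eq ⟩
          2 * (2 * q)         ≡⟨ cong (λ x → 2 * (2 * x)) q≡ ⟩
          2 ^ suc (suc (suc (2 * l))) ∎

    -- Comparing m with 2r when r + 1 is a power of four

    module _ (s l : ℕ) (r≡ : r ≡ suc (2 * s)) (suc-s : suc s ≡ 2 ^ suc (2 * l)) where

      suc-r : suc r ≡ 2 ^ (2 * suc l)
      suc-r = begin
        suc r                 ≡⟨ cong suc r≡ ⟩
        suc (suc (2 * s))     ≡⟨ ℕ.*-suc 2 s ⟨
        2 * suc s             ≡⟨ cong (2 *_) suc-s ⟩
        2 ^ (2 + 2 * l)       ≡⟨ cong (2 ^_) (ℕ.*-suc 2 l) ⟨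
        2 ^ (2 * suc l)       ∎
        where open ≡-Reasoning

      t-s : t s ≡ -1ℤ
      t-s = ℤ.neg-injective (trans (sym (t-odd s)) (trans (cong t (sym r≡)) t-r))

      0<s : 0 < s
      0<s = ℕ.n≢0⇒n>0 λ s≡0 → contradiction (trans (sym t0) (trans (cong t (sym s≡0)) t-s)) λ ()

      2s<r : 2 * s < r
      2s<r = ℕ.≤-reflexive (sym r≡)

      2<r : 2 < r
      2<r = ℕ.≤-<-trans (ℕ.*-monoʳ-≤ 2 0<s) 2s<r

      f-2s : f (2 * s) ≡ -1ℤ
      f-2s = trans (low _ 2s<r) (trans (t-even s) t-s)

      -- Since r + 1 is a power of two, t (r + j) = - t (j - 1), which cancels the term f (j - 1).
      upper-echo : ∀ {n} j → n ≡ r + j → 0 < j → j < r → f n ≡ - t j ℤ.+ shift (suc m) f n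
      upper-echo (suc j) n≡ _ j<r with trans n≡ (ℕ.+-suc r j)
      ... | refl = trans
        (step (suc (r + j)) (trans (Δdilate-low (subst (_< 2 * r) (ℕ.+-suc r j) (r+<2r j<r)))
            (trans (cong (λ x → t (x + j)) suc-r)
              (t-2^+ (2 * suc l) (subst (j <_) suc-r (ℕ.<-trans (ℕ.n<1+n j) (ℕ.m<n⇒m<1+n j<r))))))
          (trans (shift-at r (sym (ℕ.+-suc r j))) (low _ j<r))
          (trans (shift-at (suc r) refl) (low _ (ℕ.<-trans (ℕ.n<1+n j) j<r)))
          refl)
        (tidy (t j) (t (suc j)) _)
        where
        tidy : ∀ a b y → - a - b ℤ.+ a ℤ.+ y ≡ - b ℤ.+ y
        tidy = solve-∀

      upper : ∀ {n} j → n ≡ r + j → 0 < j → j < r → n ≤ m → f n ≡ - t j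
      upper j n≡ 0<j j<r n≤m = trans (upper-echo j n≡ 0<j j<r)
        (trans (cong (λ x → - t j ℤ.+ x) (shift-< (s≤s n≤m))) (ℤ.+-identityʳ _))

      f-r+1 : suc r ≤ m → f (suc r) ≡ 1ℤ
      f-r+1 le = trans (upper 1 (ℕ.+-comm 1 r) z<s (ℕ.<-trans (ℕ.n<1+n 1) 2<r) le) (cong -_ t1)

      -- Index 2r is the first at which the halved index is r, where f is 0 and not t r; only f (r -
      -- 1) = -1 survives.
      upper-r : m ≡ 2 * r → f (r + r) ≡ - t r
      upper-r m≡ = trans (step (r + r) (trans (Δdilate-even f r r+r≡2r) f-r) (trans (shift-at r refl) f-r)
          (trans (shift-at (suc r) 2r≡) f-2s)
          (shift-< (s≤s (ℕ.≤-reflexive (trans r+r≡2r (sym m≡))))))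
        (cong -_ (sym t-r))
        where
        2r≡ : r + r ≡ suc r + 2 * s
        2r≡ = trans (cong (r +_) r≡) (ℕ.+-suc r (2 * s))

      f-r+2 : r + 2 ≤ m → f (r + 2) ≡ 1ℤ
      f-r+2 le = trans (upper 2 refl z<s 2<r le) (cong -_ t2)

      f-2r+2 : 2 * r < m → ∀ {d} → shift (suc m) f (suc (suc (2 * r))) ≡ d →
        f (suc (suc (2 * r))) ≡ 1ℤ - 1ℤ ℤ.+ 1ℤ ℤ.+ d
      f-2r+2 2r<m = step (suc (suc (2 * r)))
        (trans (Δdilate-even f (suc r) (sym (ℕ.*-suc 2 r))) (f-r+1 r+1≤m))
        (trans (shift-at r (index₁ r)) (f-r+2 (ℕ.<⇒≤ (ℕ.<-trans (r+<2r 2<r) 2r<m))))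
        (trans (shift-at (suc r) (index₂ r)) (f-r+1 r+1≤m))
        where
        r+1≤m : suc r ≤ m
        r+1≤m = ℕ.≤-trans (s≤s (ℕ.m≤m+n r _)) 2r<m
        index₁ : ∀ r → suc (suc (2 * r)) ≡ r + (r + 2)
        index₁ = ℕ-Solver.solve-∀
        index₂ : ∀ r → suc (suc (2 * r)) ≡ suc r + suc r
        index₂ = ℕ-Solver.solve-∀

      -- If m = 2r + 1, the term shifted by m + 1 contributes f 0 = 1 at index 2r + 2, so the
      -- recurrence yields 2 at an index beyond m, where f is 0.
      m≯2r : ¬ 2 * r < m
      m≯2r 2r<m with suc (suc (2 * r)) ℕ.≤? m
      ... | no ≰m = contradiction
        (trans (sym (f-beyond (ℕ.≰⇒> ≰m)))
          (f-2r+2 2r<m (trans (shift-at (suc m) {0} (trans (cong suc (sym m≡)) (sym (ℕ.+-identityʳ _)))) f-0)))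
        λ ()
        where
        m≡ : m ≡ suc (2 * r)
        m≡ = ℕ.≤-antisym (ℕ.≤-pred (ℕ.≰⇒> ≰m)) 2r<m
      ... | yes 2r+2≤m = clash (trit 3r+2) (shift-Trit trit (suc m) 3r+2) (step 3r+2
            (trans (Δdilate-odd f (r + suc s) index) (cong -_ f-mid))
            (trans (shift-at r (index₁ r)) (f-2r+2 2r<m (shift-< (s≤s 2r+2≤m))))
            (trans (shift-at (suc r) (index₂ r)) f-2r+1)
            refl)
        where
        3r+2 : ℕ
        3r+2 = suc (suc (3 * r))
        index₁ : ∀ r → suc (suc (3 * r)) ≡ r + suc (suc (2 * r))
        index₁ = ℕ-Solver.solve-∀
        index₂ : ∀ r → suc (suc (3 * r)) ≡ suc r + suc (2 * r)
        index₂ = ℕ-Solver.solve-∀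
        index₃ : ∀ r → suc (2 * r) ≡ r + suc r
        index₃ = ℕ-Solver.solve-∀
        index₄ : ∀ r → suc (2 * r) ≡ suc r + r
        index₄ = ℕ-Solver.solve-∀
        index₅ : ∀ s → suc (suc (3 * suc (2 * s))) ≡ suc (2 * (suc (2 * s) + suc s))
        index₅ = ℕ-Solver.solve-∀
        index : 3r+2 ≡ suc (2 * (r + suc s))
        index = subst (λ x → suc (suc (3 * x)) ≡ suc (2 * (x + suc s))) (sym r≡) (index₅ s)
        s+1<r : suc s < r
        s+1<r = subst (suc s <_) (sym r≡) (s<s (ℕ.m<m+n s (subst (0 <_) (sym (ℕ.+-identityʳ s)) 0<s)))
        f-mid : f (r + suc s) ≡ 1ℤ
        f-mid = trans (upper (suc s) refl z<s s+1<r (ℕ.<⇒≤ (ℕ.<-trans (r+<2r s+1<r) 2r<m)))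
          (cong -_ (trans (cong t suc-s) (t-2^ (suc (2 * l)))))
        f-2r+1 : f (suc (2 * r)) ≡ -1ℤ
        f-2r+1 = step (suc (2 * r)) (trans (Δdilate-odd f r refl) (cong -_ f-r))
          (trans (shift-at r (index₃ r)) (f-r+1 (ℕ.≤-trans (s≤s (ℕ.m≤m+n r _)) 2r<m)))
          (trans (shift-at (suc r) (index₄ r)) f-r)
          (shift-< (s≤s 2r<m))
        clash : ∀ {x y} → Trit x → Trit y → x ≢ -1ℤ - 1ℤ ℤ.+ -1ℤ ℤ.+ y
        clash pos  pos  ()
        clash zero pos  ()
        clash neg  pos  ()
        clash pos  zero ()
        clash zero zero ()
        clash neg  zero ()
        clash pos  neg  ()
        clash zero neg  ()
        clash neg  neg  ()

      -- With p = 2r − m and q = m + 1 − r, both indices q + j (j < p) and p + j (j < q)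
      -- echo the initial segment of t, while p + q = r + 1 is a power of two.
      module Short (p′ q′ : ℕ) (m≡ : m ≡ r + q′) (r≡p+q′ : r ≡ suc p′ + q′) where

        p q : ℕ
        p = suc p′
        q = suc q′

        q′<r : q′ < r
        q′<r = subst (q′ <_) (sym r≡p+q′) (s≤s (ℕ.m≤n+m q′ p′))

        p′<r : p′ < r
        p′<r = subst (p′ <_) (sym r≡p+q′) (s≤s (ℕ.m≤m+n p′ q′))

        m<r+r : m < r + r
        m<r+r = subst (_< r + r) (sym m≡) (ℕ.+-monoʳ-< r q′<r)

        f-2r+ : ∀ i → f (r + r + i) ≡ 0ℤ
        f-2r+ i = f-beyond (ℕ.<-≤-trans m<r+r (ℕ.m≤m+n (r + r) i))

        2r+≡ : ∀ i → r + r + i ≡ suc m + (p′ + i)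
        2r+≡ i = begin
          r + r + i              ≡⟨ cong (λ x → r + x + i) r≡p+q′ ⟩
          r + (p + q′) + i       ≡⟨ reorder r p′ q′ i ⟩
          suc (r + q′) + (p′ + i) ≡⟨ cong (λ x → suc x + (p′ + i)) m≡ ⟨
          suc m + (p′ + i)       ∎
          where
          open ≡-Reasoning
          reorder : ∀ r p′ q′ i → r + (suc p′ + q′) + i ≡ suc (r + q′) + (p′ + i)
          reorder = ℕ-Solver.solve-∀

        -- Index 2r lies beyond m, so f (r - 1) = -1 must be cancelled by the term shifted by m + 1,
        -- which is f p′.
        t-p′ : t p′ ≡ 1ℤ
        t-p′ = solveSign (t-sign p′) (trans (sym (f-2r+ 0)) (step (r + r + 0)
          (trans (Δdilate-even f r (trans (ℕ.+-identityʳ _) r+r≡2r)) f-r)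
          (trans (shift-at r (ℕ.+-identityʳ _)) f-r)
          (trans (shift-at (suc r) (trans (ℕ.+-identityʳ _) (trans (cong (r +_) r≡) (ℕ.+-suc r (2 * s))))) f-2s)
          (trans (shift-at (suc m) (2r+≡ 0)) (trans (cong f (ℕ.+-identityʳ p′)) (low p′ p′<r)))))
          where
          solveSign : ∀ {x} → Sign x → 0ℤ ≡ 0ℤ - 0ℤ ℤ.+ -1ℤ ℤ.+ x → x ≡ 1ℤ
          solveSign pos _ = refl
          solveSign neg ()

        shift-by-q : ∀ j → j < p → t (q + j) ≡ t j
        shift-by-q j (s≤s j≤p′) with ℕ.m≤n⇒m<n∨m≡n j≤p′
        -- The last position q + p′ equals r, just outside the range of `upper-echo`; both values
        -- are already known to be 1.
        ... | inj₂ refl = trans (cong t (sym (trans r≡p+q′ (cong suc (ℕ.+-comm p′ q′))))) (trans t-r (sym t-p′))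
        ... | inj₁ j<p′ = sym (negate (t (q + j)) (t j) (trans (sym (f-beyond m<n)) (trans
            (upper-echo (q + j) refl z<s q+j<r)
            (cong (λ x → - t (q + j) ℤ.+ x) (trans (shift-at (suc m) n≡) (low j (ℕ.<-trans j<p′ p′<r)))))))
          where
          q+j<r : q + j < r
          q+j<r = subst (q + j <_) (sym (trans r≡p+q′ (cong suc (ℕ.+-comm p′ q′)))) (ℕ.+-monoʳ-< q j<p′)
          n≡ : r + (q + j) ≡ suc m + j
          n≡ = begin
            r + (suc q′ + j)    ≡⟨ reorder r q′ j ⟩
            suc (r + q′) + j    ≡⟨ cong (λ x → suc x + j) m≡ ⟨
            suc m + j           ∎
            where
            open ≡-Reasoning
            reorder : ∀ r q′ j → r + (suc q′ + j) ≡ suc (r + q′) + j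
            reorder = ℕ-Solver.solve-∀
          m<n : m < r + (q + j)
          m<n = subst (m <_) (sym n≡) (s≤s (ℕ.m≤m+n m j))
          negate : ∀ a b → 0ℤ ≡ - a ℤ.+ b → b ≡ a
          negate a b eq = trans (lemma a b) (trans (cong (λ x → a ℤ.+ x) (sym eq)) (ℤ.+-identityʳ a))
            where
            lemma : ∀ a b → b ≡ a ℤ.+ (- a ℤ.+ b)
            lemma = solve-∀

        upper′ : ∀ j → 0 < j → j ≤ q′ → f (r + j) ≡ - t j
        upper′ j 0<j j≤q′ = upper j refl 0<j (ℕ.≤-<-trans j≤q′ q′<r) (subst (r + j ≤_) (sym m≡) (ℕ.+-monoʳ-≤ r j≤q′))

        -- Halving 2r + i leads to r + k with k = ⌊i/2⌋, where f is - t k. The values i ≤ 1 lead to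
        -- r itself, where f is 0.
        Δdilate-2r+ : ∀ i → 1 < i → i ≤ q′ → Δ (dilate f) (r + r + i) ≡ - t i
        Δdilate-2r+ i 1<i i≤q′ with half i
        Δdilate-2r+ _ _ i≤q′ | even (suc k) = begin
          Δ (dilate f) (r + r + 2 * suc k)   ≡⟨ Δdilate-even f (r + suc k) (index r (suc k)) ⟩
          f (r + suc k)                      ≡⟨ upper′ (suc k) z<s (ℕ.≤-trans (ℕ.m≤m+n (suc k) _) i≤q′) ⟩
          - t (suc k)                        ≡⟨ cong -_ (t-even (suc k)) ⟨
          - t (2 * suc k)                    ∎
          where
          open ≡-Reasoning
          index : ∀ r k → r + r + 2 * k ≡ 2 * (r + k)
          index = ℕ-Solver.solve-∀
        Δdilate-2r+ _ _ i≤q′ | odd (suc k) = begin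
          Δ (dilate f) (r + r + suc (2 * suc k)) ≡⟨ Δdilate-odd f (r + suc k) (index r (suc k)) ⟩
          - f (r + suc k)                    ≡⟨ cong -_ (upper′ (suc k) z<s (ℕ.≤-trans (ℕ.m≤m+n (suc k) _) (ℕ.≤-trans (ℕ.n≤1+n _) i≤q′))) ⟩
          - - t (suc k)                      ≡⟨ cong -_ (t-odd (suc k)) ⟨
          - t (suc (2 * suc k))              ∎
          where
          open ≡-Reasoning
          index : ∀ r k → r + r + suc (2 * k) ≡ suc (2 * (r + k))
          index = ℕ-Solver.solve-∀
        Δdilate-2r+ _ () _ | even zero
        Δdilate-2r+ _ (s≤s ()) _ | odd zero

        -- At index 2r + j + 1, beyond m, the term shifted by m + 1 is f (p + j). The halved term
        -- cancels f (r + j + 1), which leaves f (r + j) = - t j to be balanced; j = 0 is separate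
        -- because f r = 0. The bound is q′ so that r + j + 1 ≤ m.
        shift-by-p : ∀ j → j < q′ → t (p + j) ≡ t j
        shift-by-p j j<q′ = trans (sym (low (p + j) p+j<r)) (trans (sym (trans (shift-at (suc m) (2r+≡ (suc j))) (cong f (ℕ.+-suc p′ j)))) (go j j<q′))
          where
          p+j<r : p + j < r
          p+j<r = subst (p + j <_) (sym r≡p+q′) (ℕ.+-monoʳ-< p j<q′)
          go : ∀ j → j < q′ → shift (suc m) f (r + r + suc j) ≡ t j
          go zero 0<q′ = trans (solveAt (trans (sym (f-2r+ 1)) (step (r + r + 1)
              (trans (Δdilate-odd f r (index r)) (cong -_ f-r))
              (trans (shift-at r (ℕ.+-assoc r r 1)) (trans (upper′ 1 z<s 0<q′) (cong -_ t1)))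
              (trans (shift-at (suc r) (ℕ.+-comm (r + r) 1)) f-r)
              refl))) (sym t0)
            where
            index : ∀ r → r + r + 1 ≡ suc (2 * r)
            index = ℕ-Solver.solve-∀
            solveAt : ∀ {y} → 0ℤ ≡ 0ℤ - 1ℤ ℤ.+ 0ℤ ℤ.+ y → y ≡ 1ℤ
            solveAt {y} eq = trans (lemma y) (cong (λ x → 1ℤ ℤ.+ x) (sym eq))
              where
              lemma : ∀ y → y ≡ 1ℤ ℤ.+ (0ℤ - 1ℤ ℤ.+ 0ℤ ℤ.+ y)
              lemma = solve-∀
          go (suc j) j<q′ = solveAt (t (suc (suc j))) (t (suc j)) _ (trans (sym (f-2r+ (suc (suc j)))) (step (r + r + suc (suc j))
              (Δdilate-2r+ (suc (suc j)) (s<s z<s) j<q′)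
              (trans (shift-at r (ℕ.+-assoc r r (suc (suc j)))) (upper′ (suc (suc j)) z<s j<q′))
              (trans (shift-at (suc r) (index r j)) (upper′ (suc j) z<s (ℕ.<⇒≤ j<q′)))
              refl))
            where
            index : ∀ r j → r + r + suc (suc j) ≡ suc r + (r + suc j)
            index = ℕ-Solver.solve-∀
            solveAt : ∀ a b y → 0ℤ ≡ - a - (- a) ℤ.+ - b ℤ.+ y → y ≡ b
            solveAt a b y eq = trans (lemma a b y) (trans (cong (λ x → b ℤ.+ x) (sym eq)) (ℤ.+-identityʳ b))
              where
              lemma : ∀ a b y → y ≡ b ℤ.+ (- a - (- a) ℤ.+ - b ℤ.+ y)
              lemma = solve-∀

        -- Together with `t-p′` this makes t agree at p - 1 and p, so p cannot be odd.
        t-p : t p ≡ 1ℤ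
        t-p with q′ ℕ.≟ 0
        ... | yes q′≡0 = trans (cong t (sym (trans r≡p+q′ (trans (cong (p +_) q′≡0) (ℕ.+-identityʳ p))))) t-r
        ... | no q′≢0  = trans (cong t (sym (ℕ.+-identityʳ p))) (trans (shift-by-p 0 (ℕ.n≢0⇒n>0 q′≢0)) t0)

        p+q : p + q ≡ 2 * suc s
        p+q = begin
          p + suc q′         ≡⟨ ℕ.+-suc p q′ ⟩
          suc (p + q′)       ≡⟨ cong suc r≡p+q′ ⟨
          suc r              ≡⟨ cong suc r≡ ⟩
          suc (suc (2 * s))  ≡⟨ ℕ.*-suc 2 s ⟨
          2 * suc s          ∎
          where open ≡-Reasoning

        impossible : ⊥
        impossible = go (half p) (half q) refl refl
          where
          go : ∀ {a b} → Half a → Half b → p ≡ a → q ≡ b → ⊥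
          go (odd a) _ p≡ _ = t-odd≢even a (trans (cong t (sym p≡)) (trans t-p (trans (sym t-p′) (cong t (ℕ.suc-injective p≡)))))
          go (even a) (odd b) p≡ q≡ = ℕ.even≢odd (suc s) (a + b) (trans (sym p+q)
            (trans (cong₂ _+_ p≡ q≡) (trans (ℕ.+-suc (2 * a) (2 * b)) (cong suc (sym (ℕ.*-distribˡ-+ 2 a b))))))
          go (even a) (even b) p≡ q≡ = complementary-shifts-impossible (suc (2 * l)) a b
            (ℕ.*-cancelˡ-< 2 0 a (subst (0 <_) p≡ z<s))
            (ℕ.*-cancelˡ-< 2 0 b (subst (0 <_) q≡ z<s))
            (trans (ℕ.*-cancelˡ-≡ (a + b) (suc s) 2 (trans (ℕ.*-distribˡ-+ 2 a b) (trans (cong₂ _+_ (sym p≡) (sym q≡)) p+q))) suc-s)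
            (λ j j<a → t-halve-unsigned b j (trans (cong (λ x → t (x + 2 * j)) (sym q≡)) (shift-by-q (2 * j) (subst (2 * j <_) (sym p≡) (ℕ.*-monoʳ-< 2 j<a)))))
            -- With q = 2b, an even position 2j below q is at most q - 2, hence below q′.
            (λ j j<b → t-halve-unsigned a j (trans (cong (λ x → t (x + 2 * j)) (sym p≡)) (shift-by-p (2 * j)
               (ℕ.≤-pred (subst (suc (suc (2 * j)) ≤_) (sym q≡) (subst (_≤ 2 * b) (ℕ.*-suc 2 j) (ℕ.*-monoʳ-≤ 2 j<b)))))))

      m≮2r : ¬ m < 2 * r
      m≮2r m<2r =
        let q′ , r+q′≡m = ℕ.m≤n⇒∃[o]m+o≡n r≤m
            q′<r = ℕ.+-cancelˡ-< r q′ r (subst (_< r + r) (sym r+q′≡m) (subst (m <_) (sym r+r≡2r) m<2r))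
            p′ , q+p′≡r = ℕ.m≤n⇒∃[o]m+o≡n q′<r
        in Short.impossible p′ q′ (sym r+q′≡m) (trans (sym q+p′≡r) (cong suc (ℕ.+-comm q′ p′)))

      shape : Shape m r f
      shape with ℕ.<-cmp m (2 * r)
      ... | tri< lt _ _ = contradiction lt m≮2r
      ... | tri> _ _ gt = contradiction gt m≯2r
      ... | tri≈ _ eq _ = record
        { l = suc l ; suc-r = suc-r ; m≡2r = eq ; lower = low ; upper = up }
        where
        up : ∀ j → 0 < j → j ≤ r → f (r + j) ≡ - t j
        up j 0<j j≤r with ℕ.m≤n⇒m<n∨m≡n j≤r
        ... | inj₁ j<r  = upper j refl 0<j j<r (ℕ.≤-trans (ℕ.<⇒≤ (r+<2r j<r)) (ℕ.≤-reflexive (sym eq)))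
        ... | inj₂ refl = upper-r eq

    r>0⇒shape : Shape m r f
    r>0⇒shape = go (half r) refl
      where
      go : ∀ {n} → Half n → r ≡ n → Shape m r f
      go (even s) r≡ = contradiction r≡ (r-not-even s)
      go (odd s)  r≡ = let l , suc-s = r-odd s r≡ in shape s l r≡ suc-s

-- Verifying the solution

dilate-shift : ∀ k f n → dilate (shift k f) n ≡ shift (2 * k) (dilate f) n
dilate-shift zero    f n = refl
dilate-shift (suc k) f n rewrite ℕ.+-suc k (k + 0) = go n
  where
  go : ∀ n → dilate (shift (suc k) f) n ≡ shift (suc (suc (2 * k))) (dilate f) n
  go zero          = refl
  go (suc zero)    = refl
  go (suc (suc n)) = dilate-shift k f n

Δ-shift : ∀ k g n → Δ (shift k g) n ≡ shift k (Δ g) n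
Δ-shift zero    g n             = refl
Δ-shift (suc k) g zero          = refl
Δ-shift (suc k) g (suc zero)    = trans (ℤ.+-identityʳ _) (Δ-shift k g 0)
Δ-shift (suc k) g (suc (suc n)) = Δ-shift k g (suc n)

Δdilate-- : ∀ f g n → Δ (dilate (λ i → f i - g i)) n ≡ Δ (dilate f) n - Δ (dilate g) n
Δdilate-- f g n = trans (Δ-cong (dilate-- f g) n) (Δ-- n)
  where
  interchange : ∀ a b c d → (a - b) - (c - d) ≡ (a - c) - (b - d)
  interchange = solve-∀
  Δ-- : ∀ n → Δ (λ i → dilate f i - dilate g i) n ≡ Δ (dilate f) n - Δ (dilate g) n
  Δ-- zero    = refl
  Δ-- (suc n) = interchange (dilate f (suc n)) (dilate g (suc n)) (dilate f n) (dilate g n)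

dilate-cong : ∀ {f g} → f ≗ g → dilate f ≗ dilate g
dilate-cong e zero          = e 0
dilate-cong e (suc zero)    = refl
dilate-cong e (suc (suc n)) = dilate-cong (e ∘ suc) n

-- τ(x) = ∏_{i<k} (1 − x^{2^i}), and for even k the solution is f(x) = (1 − xʳ) τ(x) with r = 2ᵏ − 1.
module Truncated (k : ℕ) where

  τ : ℕ → ℤ
  τ n with n ℕ.<? 2 ^ k
  ... | yes _ = t n
  ... | no _  = 0ℤ

  τ-< : ∀ {n} → n < 2 ^ k → τ n ≡ t n
  τ-< {n} n<N with n ℕ.<? 2 ^ k
  ... | yes _  = refl
  ... | no n≮N = contradiction n<N n≮N

  τ-≥ : ∀ {n} → 2 ^ k ≤ n → τ n ≡ 0ℤ
  τ-≥ {n} N≤n with n ℕ.<? 2 ^ k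
  ... | yes n<N = contradiction n<N (ℕ.≤⇒≯ N≤n)
  ... | no _    = refl

  Δdilate-τ-low : ∀ {n} → n < 2 * 2 ^ k → Δ (dilate τ) n ≡ t n
  Δdilate-τ-low {n} n<2N = trans
    (Δdilate-cong n (λ i le → τ-< (ℕ.*-cancelˡ-< 2 i (2 ^ k) (ℕ.≤-<-trans le n<2N))))
    (t-Δdilate n)

  Δdilate-τ-high : ∀ {n} → 2 * 2 ^ k ≤ n → Δ (dilate τ) n ≡ 0ℤ
  Δdilate-τ-high {n} 2N≤n with half n
  ... | even i = trans (Δdilate-even τ i refl) (τ-≥ (ℕ.*-cancelˡ-≤ 2 2N≤n))
  ... | odd i  = trans (Δdilate-odd τ i refl) (cong -_ (τ-≥ (ℕ.≤-pred (ℕ.*-cancelˡ-< 2 (2 ^ k) (suc i)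
    (subst (2 * 2 ^ k <_) (sym (ℕ.*-suc 2 i)) (s≤s 2N≤n))))))

  -- Replacing x by x² turns the factors i < k into 1 ≤ i ≤ k, and 1 - x restores i = 0, so the
  -- result is (1 - x^(2ᵏ)) τ(x). Coefficientwise the extra factor is the sign change of `t-2^+`.
  Δdilate-τ : ∀ n → Δ (dilate τ) n ≡ τ n - shift (2 ^ k) τ n
  Δdilate-τ n with n ℕ.<? 2 ^ k
  ... | yes n<N = trans (Δdilate-τ-low (ℕ.<-≤-trans n<N (ℕ.m≤m+n (2 ^ k) _)))
    (sym (trans (cong (λ x → t n - x) (shift-< n<N)) (ℤ.+-identityʳ (t n))))
  ... | no n≮N with ℕ.m≤n⇒∃[o]m+o≡n (ℕ.≮⇒≥ n≮N)
  ...   | j , refl with j ℕ.<? 2 ^ k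
  ...     | yes j<N = trans
    (trans (Δdilate-τ-low (ℕ.+-monoʳ-< (2 ^ k) (subst (j <_) (sym (ℕ.+-identityʳ _)) j<N))) (t-2^+ k j<N))
    (sym (trans (cong (λ x → 0ℤ - x) (trans (shift-at (2 ^ k) refl) (τ-< j<N))) (ℤ.+-identityˡ _)))
  ...     | no j≮N = trans
    (Δdilate-τ-high (ℕ.+-monoʳ-≤ (2 ^ k) (subst (_≤ j) (sym (ℕ.+-identityʳ _)) (ℕ.≮⇒≥ j≮N))))
    (sym (cong (λ x → 0ℤ - x) (trans (shift-at (2 ^ k) refl) (τ-≥ (ℕ.≮⇒≥ j≮N)))))

module _ {m r : ℕ} {f : ℕ → ℤ} (f-r : f r ≡ 0ℤ) (f-beyond : ∀ {n} → m < n → f n ≡ 0ℤ) (shape : Shape m r f) where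

  open Shape shape
  open Truncated (2 * l)

  f≗τ-shift : f ≗ (λ n → τ n - shift r τ n)
  f≗τ-shift n with ℕ.<-cmp n r
  ... | tri< n<r _ _ = trans (lower n n<r) (sym (trans
    (cong₂ _-_ (τ-< (subst (n <_) suc-r (ℕ.m<n⇒m<1+n n<r))) (shift-< n<r)) (ℤ.+-identityʳ (t n))))
  -- The zero at r comes from t r - t 0, where t r = 1 because the exponent 2l is even.
  ... | tri≈ _ refl _ = trans f-r (sym (cong₂ _-_
    (trans (τ-< (subst (r <_) suc-r (ℕ.n<1+n r))) (trans (t-pred-2^ (2 * l) suc-r) (-1^even l)))
    (trans (shift-at r (sym (ℕ.+-identityʳ r))) (trans (τ-< (subst (0 <_) suc-r z<s)) t0))))
  ... | tri> _ _ r<n with ℕ.m≤n⇒∃[o]m+o≡n (ℕ.<⇒≤ r<n)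
  ...   | j , refl with j ℕ.≤? r
  ...     | yes j≤r = trans (upper j (ℕ.+-cancelˡ-< r 0 j (subst (_< r + j) (sym (ℕ.+-identityʳ r)) r<n)) j≤r) (sym (trans
    (cong₂ _-_ (τ-≥ (subst (_≤ r + j) suc-r r<n)) (trans (shift-at r refl) (τ-< (subst (j <_) suc-r (s≤s j≤r)))))
    (ℤ.+-identityˡ _)))
  ...     | no j≰r = trans
    (f-beyond (subst (_< r + j) (sym m≡2r) (ℕ.+-monoʳ-< r (subst (_< j) (sym (ℕ.+-identityʳ r)) (ℕ.≰⇒> j≰r)))))
    (sym (cong₂ _-_ (τ-≥ (subst (_≤ r + j) suc-r r<n))
      (trans (shift-at r refl) (τ-≥ (subst (_≤ j) suc-r (ℕ.≰⇒> j≰r))))))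

  shift-f : ∀ k n → shift k f n ≡ shift k τ n - shift (k + r) τ n
  shift-f k n = trans (shift-cong k f≗τ-shift n) (trans (shift-- τ (shift r τ) k n) (cong (λ x → shift k τ n - x) (shift-shift τ k r n)))

  -- For m = 2r the mask 1 + xʳ - x^(r+1) - x^(m+1) factors as (1 + xʳ)(1 - x^(r+1)). Multiplied by
  -- 1 - xʳ it becomes (1 - x^(2r))(1 - x^(r+1)), and `Δdilate-τ` converts (1 - x^(r+1)) τ(x) into
  -- (1 - x) τ(x²).
  shape⇒masked : masked m r f ≗ Δ (dilate f)
  shape⇒masked n = begin
    masked m r f n
      ≡⟨ cong₂ _-_ (cong₂ _-_ (cong₂ ℤ._+_ (f≗τ-shift n) (shift-f r n)) (shift-f (suc r) n)) (shift-f (suc m) n) ⟩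
    (τ n - τ₁) ℤ.+ (τ₁ - shift (r + r) τ n) - (shift (suc r) τ n - shift (suc r + r) τ n) - (shift (suc m) τ n - shift (suc m + r) τ n)
      ≡⟨ cong (λ x → (τ n - τ₁) ℤ.+ (τ₁ - shift x τ n) - (shift (suc r) τ n - shift (suc x) τ n) - (shift (suc m) τ n - shift (suc m + r) τ n)) (sym m≡r+r) ⟩
    (τ n - τ₁) ℤ.+ (τ₁ - shift m τ n) - (shift (suc r) τ n - shift (suc m) τ n) - (shift (suc m) τ n - shift (suc m + r) τ n)
      ≡⟨ telescope (τ n) τ₁ (shift m τ n) (shift (suc r) τ n) (shift (suc m) τ n) (shift (suc m + r) τ n) ⟩
    (τ n - shift (suc r) τ n) - (shift m τ n - shift (suc m + r) τ n)
      ≡⟨ cong₂ (λ x y → (τ n - shift x τ n) - (shift m τ n - shift y τ n)) suc-r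
           (trans (sym (ℕ.+-suc m r)) (cong (m +_) suc-r)) ⟩
    (τ n - shift N τ n) - (shift m τ n - shift (m + N) τ n)
      ≡⟨ cong (λ x → (τ n - shift N τ n) - (shift m τ n - x)) (shift-shift τ m N n) ⟨
    (τ n - shift N τ n) - (shift m τ n - shift m (shift N τ) n)
      ≡⟨ cong₂ _-_ (Δdilate-τ n) (trans (shift-cong m Δdilate-τ n) (shift-- τ (shift N τ) m n)) ⟨
    Δ (dilate τ) n - shift m (Δ (dilate τ)) n
      ≡⟨ cong (λ x → Δ (dilate τ) n - x) (begin
           Δ (dilate (shift r τ)) n         ≡⟨ Δ-cong (dilate-shift r τ) n ⟩
           Δ (shift (2 * r) (dilate τ)) n   ≡⟨ Δ-shift (2 * r) (dilate τ) n ⟩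
           shift (2 * r) (Δ (dilate τ)) n   ≡⟨ cong (λ x → shift x (Δ (dilate τ)) n) m≡2r ⟨
           shift m (Δ (dilate τ)) n         ∎) ⟨
    Δ (dilate τ) n - Δ (dilate (shift r τ)) n
      ≡⟨ Δdilate-- τ (shift r τ) n ⟨
    Δ (dilate (λ i → τ i - shift r τ i)) n
      ≡⟨ Δ-cong (dilate-cong f≗τ-shift) n ⟨
    Δ (dilate f) n ∎
    where
    open ≡-Reasoning
    N  = 2 ^ (2 * l)
    τ₁ = shift r τ n
    m≡r+r : m ≡ r + r
    m≡r+r = trans m≡2r (cong (r +_) (ℕ.+-identityʳ r))
    telescope : ∀ a b c d e g → (a - b) ℤ.+ (b - c) - (d - e) - (e - g) ≡ (a - d) - (c - g)
    telescope = solve-∀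

-- Passing between the sets C, D and the series f

R-zero : ∀ {S : Pred ℕ 0ℓ} (S? : Decidable S) → R S? 0 ≡ 0
R-zero S? = ℤ.+-injective (trans (R-antidiag S? 0) (ℤ.*-zeroʳ (⟦ S? 0 ⟧ ℤ.* ⟦ S? 0 ⟧)))

-- At k = 2^(2l) ∸ 1 this unfolds to the sets in the theorem; a free k can be exchanged for r.
glue : Pred ℕ 0ℓ → Pred ℕ 0ℓ → ℕ → Pred ℕ 0ℓ
glue S T k = (S ∩ [ 0 ⋯ k ]) ∪ (k +ˢ (T ∩ [ 0 ⋯ k ]))

-- The blocks meet at r, which may be the last point of the first or the first point of the second.
-- The disjunction tells which: C gets r from r ∈ A, and D from 0 ∈ A.
≐-glue : ∀ {P S T : Pred ℕ 0ℓ} r → P r → S r ⊎ T 0 → (∀ {n} → P n → n ≤ 2 * r) →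
  (∀ n → n < r → P n ⇔ S n) → (∀ j → 0 < j → j ≤ r → P (r + j) ⇔ T j) → P ≐ glue S T r
≐-glue {P} {S} {T} r Pr middle P≤2r low high = to , from
  where
  to : ∀ {n} → P n → glue S T r n
  to {n} Pn with ℕ.<-cmp n r
  ... | tri< n<r _ _  = inj₁ (Equivalence.to (low n n<r) Pn , z≤n , ℕ.<⇒≤ n<r)
  ... | tri≈ _ refl _ = [ (λ Sr → inj₁ (Sr , z≤n , ℕ.≤-refl)) , (λ T0 → inj₂ (0 , (T0 , z≤n , z≤n) , sym (ℕ.+-identityʳ r))) ]′ middle
  ... | tri> _ _ r<n with ℕ.m≤n⇒∃[o]m+o≡n (ℕ.<⇒≤ r<n)
  ...   | j , refl = inj₂ (j , (Equivalence.to (high j 0<j j≤r) Pn , z≤n , j≤r) , refl)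
    where
    0<j : 0 < j
    0<j = ℕ.+-cancelˡ-< r 0 j (subst (_< r + j) (sym (ℕ.+-identityʳ r)) r<n)
    j≤r : j ≤ r
    j≤r = subst (j ≤_) (ℕ.+-identityʳ r) (ℕ.+-cancelˡ-≤ r j (r + 0) (P≤2r Pn))
  from : ∀ {n} → glue S T r n → P n
  from {n} (inj₁ (Sn , _ , n≤r)) with ℕ.m≤n⇒m<n∨m≡n n≤r
  ... | inj₁ n<r  = Equivalence.from (low n n<r) Sn
  ... | inj₂ refl = Pr
  from (inj₂ (zero    , _                , refl)) = subst P (sym (ℕ.+-identityʳ r)) Pr
  from (inj₂ (j@(suc _) , (Tj , _ , j≤r) , refl)) = Equivalence.from (high j z<s j≤r) Tj

module Partition (m r : ℕ) {C D : Pred ℕ 0ℓ} (C? : Decidable C) (D? : Decidable D)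
  (C∪D≐[0⋯m] : C ∪ D ≐ [ 0 ⋯ m ]) (C∩D≐｛r｝ : C ∩ D ≐ ｛ r ｝) where

  signed : ℕ → ℤ
  signed n = ⟦ C? n ⟧ - ⟦ D? n ⟧

  Cr : C r
  Cr = proj₁ (proj₂ C∩D≐｛r｝ refl)
  Dr : D r
  Dr = proj₂ (proj₂ C∩D≐｛r｝ refl)
  C⊆ : ∀ {n} → C n → n ≤ m
  C⊆ c = proj₂ (proj₁ C∪D≐[0⋯m] (inj₁ c))
  D⊆ : ∀ {n} → D n → n ≤ m
  D⊆ d = proj₂ (proj₁ C∪D≐[0⋯m] (inj₂ d))

  total : (λ n → ⟦ C? n ⟧ ℤ.+ ⟦ D? n ⟧) ≗ (λ n → below m n ℤ.+ δ r n)
  total n with C? n | D? n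
  ... | yes c | yes d rewrite below-≤ (C⊆ c) | proj₁ C∩D≐｛r｝ (c , d) | δ-refl n = refl
  ... | yes c | no ¬d rewrite below-≤ (C⊆ c) | δ-≢ r n (λ { refl → ¬d Dr }) = refl
  ... | no ¬c | yes d rewrite below-≤ (D⊆ d) | δ-≢ r n (λ { refl → ¬c Cr }) = refl
  ... | no ¬c | no ¬d rewrite δ-≢ r n (λ { refl → ¬c Cr })
      | below-> (ℕ.≰⇒> (λ n≤m → [ ¬c , ¬d ]′ (proj₂ C∪D≐[0⋯m] (z≤n , n≤m)))) = refl

  -- The defect in f(x) u(x) = f(x²) is exactly 2 (R_C - R_D). As 2 cancels in the integers, this
  -- serves both directions.
  R-difference : ∀ n → ((λ i → ⟦ C? i ⟧ ℤ.+ ⟦ D? i ⟧) ⊛ signed) n ≡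
    ⁺ 2 ℤ.* (⁺ R C? n - ⁺ R D? n) ℤ.+ dilate signed n
  R-difference n = begin
    ((λ i → ⟦ C? i ⟧ ℤ.+ ⟦ D? i ⟧) ⊛ signed) n
      ≡⟨ difference-of-squares (λ i → ⟦ C? i ⟧) (λ i → ⟦ D? i ⟧) n ⟩
    _
      ≡⟨ cong₂ _-_ (⊛-self C? n) (⊛-self D? n) ⟩
    _
      ≡⟨ rearrange (⁺ R C? n) (⁺ R D? n) (dilate (λ i → ⟦ C? i ⟧) n) (dilate (λ i → ⟦ D? i ⟧) n) ⟩
    ⁺ 2 ℤ.* (⁺ R C? n - ⁺ R D? n) ℤ.+ (dilate (λ i → ⟦ C? i ⟧) n - dilate (λ i → ⟦ D? i ⟧) n)
      ≡⟨ cong (λ x → ⁺ 2 ℤ.* (⁺ R C? n - ⁺ R D? n) ℤ.+ x) (dilate-- (λ i → ⟦ C? i ⟧) (λ i → ⟦ D? i ⟧) n) ⟨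
    ⁺ 2 ℤ.* (⁺ R C? n - ⁺ R D? n) ℤ.+ dilate signed n ∎
    where
    open ≡-Reasoning
    rearrange : ∀ a b x y → (a ℤ.+ a ℤ.+ x) - (b ℤ.+ b ℤ.+ y) ≡ ⁺ 2 ℤ.* (a - b) ℤ.+ (x - y)
    rearrange = solve-∀

  R≗⇒masked : R C? ≗ R D? → masked m r signed ≗ Δ (dilate signed)
  R≗⇒masked eq n = trans (sym (Δ-⊛-masked m r signed total n)) (Δ-cong conv n)
    where
    conv : ((λ i → ⟦ C? i ⟧ ℤ.+ ⟦ D? i ⟧) ⊛ signed) ≗ dilate signed
    conv k = trans (R-difference k) (trans
      (cong (λ x → ⁺ 2 ℤ.* x ℤ.+ dilate signed k) (ℤ.i≡j⇒i-j≡0 (cong ⁺_ (eq k))))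
      (ℤ.+-identityˡ _))

  masked⇒R≗ : masked m r signed ≗ Δ (dilate signed) → R C? ≗ R D?
  masked⇒R≗ eq n = ℤ.+-injective (ℤ.i-j≡0⇒i≡j _ _ (ℤ.*-cancelˡ-≡ (⁺ 2) _ _ (ℤ+.∙-cancelʳ (dilate signed n) _ _
    (trans (sym (R-difference n)) (trans (conv n) (sym (ℤ.+-identityˡ _)))))))
    where
    conv : ((λ i → ⟦ C? i ⟧ ℤ.+ ⟦ D? i ⟧) ⊛ signed) ≗ dilate signed
    conv = Δ-injective (λ k → trans (Δ-⊛-masked m r signed total k) (eq k))

  signed-Trit : ∀ n → Trit (signed n)
  signed-Trit n with C? n | D? n
  ... | yes _ | yes _ = zero
  ... | yes _ | no _  = pos
  ... | no _  | yes _ = neg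
  ... | no _  | no _  = zero

  signed-r : signed r ≡ 0ℤ
  signed-r = cong₂ _-_ (⟦⟧-yes (C? r) Cr) (⟦⟧-yes (D? r) Dr)

  signed-beyond : ∀ {n} → m < n → signed n ≡ 0ℤ
  signed-beyond {n} m<n = cong₂ _-_ (⟦⟧-no (C? n) (ℕ.<⇒≱ m<n ∘ C⊆)) (⟦⟧-no (D? n) (ℕ.<⇒≱ m<n ∘ D⊆))

  C⇒signed : ∀ {n} → n ≢ r → C n → signed n ≡ 1ℤ
  C⇒signed {n} n≢r c = cong₂ _-_ (⟦⟧-yes (C? n) c) (⟦⟧-no (D? n) (λ d → n≢r (sym (proj₁ C∩D≐｛r｝ (c , d)))))

  D⇒signed : ∀ {n} → n ≢ r → D n → signed n ≡ -1ℤ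
  D⇒signed {n} n≢r d = cong₂ _-_ (⟦⟧-no (C? n) (λ c → n≢r (sym (proj₁ C∩D≐｛r｝ (c , d))))) (⟦⟧-yes (D? n) d)

  signed⇒C : ∀ n → signed n ≡ 1ℤ → C n
  signed⇒C n eq with C? n | D? n
  ... | yes c | _     = c
  signed⇒C n () | no _ | yes _
  signed⇒C n () | no _ | no _

  signed⇒D : ∀ n → signed n ≡ -1ℤ → D n
  signed⇒D n eq with C? n | D? n
  ... | _     | yes d = d
  signed⇒D n () | yes _ | no _
  signed⇒D n () | no _  | no _

  signed-Sign : ∀ {n} → n ≤ m → n ≢ r → Sign (signed n)
  signed-Sign n≤m n≢r with proj₂ C∪D≐[0⋯m] (z≤n , n≤m)
  ... | inj₁ c = subst Sign (sym (C⇒signed n≢r c)) pos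
  ... | inj₂ d = subst Sign (sym (D⇒signed n≢r d)) neg

  equal-R⇒shape : 0 ∈ C → (∀ n → 0 < n → R C? n ≡ R D? n) → Shape m r signed
  equal-R⇒shape 0∈C eq = go (r ℕ.≟ 0)
    where
    R≗ : R C? ≗ R D?
    R≗ zero    = trans (R-zero C?) (sym (R-zero D?))
    R≗ (suc n) = eq (suc n) z<s
    open Solution (C⊆ Cr) signed-Trit signed-r signed-beyond (R≗⇒masked R≗)
    go : Dec (r ≡ 0) → Shape m r signed
    go (yes r≡0) = r≡0⇒shape r≡0 (λ 1≤m → signed-Sign 1≤m (λ 1≡r → contradiction (trans 1≡r r≡0) λ ()))
    go (no r≢0)  = r>0⇒shape (ℕ.n≢0⇒n>0 r≢0) (C⇒signed (r≢0 ∘ sym) 0∈C)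

  glued : ℕ → Set
  glued k = C ≐ glue A B k × D ≐ glue B A k

  shape⇒glued : Shape m r signed → ∃[ l ] glued (2 ^ (2 * l) ∸ 1)
  shape⇒glued shape = l , subst glued (cong (_∸ 1) suc-r)
    ( ≐-glue r Cr (inj₁ (t⇒A r (trans (t-pred-2^ (2 * l) suc-r) (-1^even l)))) (λ c → subst (_ ≤_) m≡2r (C⊆ c))
        (λ n n<r → mk⇔ (λ c → t⇒A n (trans (sym (lower n n<r)) (C⇒signed (ℕ.<⇒≢ n<r) c)))
                       (λ a → signed⇒C n (trans (lower n n<r) (A⇒t n a))))
        (λ j 0<j j≤r → mk⇔ (λ c → t⇒B j (ℤ.neg-injective (trans (sym (upper j 0<j j≤r)) (C⇒signed (r+j≢r 0<j) c))))
                           (λ b → signed⇒C (r + j) (trans (upper j 0<j j≤r) (cong -_ (B⇒t j b)))))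
    , ≐-glue r Dr (inj₂ (t⇒A 0 t0)) (λ d → subst (_ ≤_) m≡2r (D⊆ d))
        (λ n n<r → mk⇔ (λ d → t⇒B n (trans (sym (lower n n<r)) (D⇒signed (ℕ.<⇒≢ n<r) d)))
                       (λ b → signed⇒D n (trans (lower n n<r) (B⇒t n b))))
        (λ j 0<j j≤r → mk⇔ (λ d → t⇒A j (ℤ.neg-injective (trans (sym (upper j 0<j j≤r)) (D⇒signed (r+j≢r 0<j) d))))
                           (λ a → signed⇒D (r + j) (trans (upper j 0<j j≤r) (cong -_ (A⇒t j a)))))
    )
    where
    open Shape shape
    r+j≢r : ∀ {j} → 0 < j → r + j ≢ r
    r+j≢r 0<j eq = ℕ.<⇒≢ (ℕ.m<m+n r 0<j) (sym eq)

  -- Since k has 2l ones, k ∈ A, and 0 ∈ A too. So k lies in both sets, which gives k = r, and k + k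
  -- ∈ D is the maximum, which gives m = 2k.
  glued⇒shape : ∀ l k → suc k ≡ 2 ^ (2 * l) → glued k → Shape m r signed
  glued⇒shape l k suc-k (C≐ , D≐) = go k≡r m≡2k
    where
    A-k : A k
    A-k = t⇒A k (trans (t-pred-2^ (2 * l) suc-k) (-1^even l))
    k≡r : k ≡ r
    k≡r = sym (proj₁ C∩D≐｛r｝
      ( proj₂ C≐ (inj₁ (A-k , z≤n , ℕ.≤-refl))
      , proj₂ D≐ (inj₂ (0 , (t⇒A 0 t0 , z≤n , z≤n) , sym (ℕ.+-identityʳ k)))))
    glue≤ : ∀ {S T n} → glue S T k n → n ≤ k + k
    glue≤ (inj₁ (_ , _ , n≤k))            = ℕ.≤-trans n≤k (ℕ.m≤m+n k k)
    glue≤ (inj₂ (_ , (_ , _ , b≤k) , refl)) = ℕ.+-monoʳ-≤ k b≤k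
    m≡2k : m ≡ k + k
    m≡2k = ℕ.≤-antisym
      ([ (λ c → glue≤ {A} {B} (proj₁ C≐ c)) , (λ d → glue≤ {B} {A} (proj₁ D≐ d)) ]′ (proj₂ C∪D≐[0⋯m] (z≤n , ℕ.≤-refl)))
      (D⊆ (proj₂ D≐ (inj₂ (k , (A-k , z≤n , ℕ.≤-refl) , refl))))
    go : k ≡ r → m ≡ k + k → Shape m r signed
    go refl m≡ = record
      { l     = l
      ; suc-r = suc-k
      ; m≡2r  = trans m≡ (cong (k +_) (sym (ℕ.+-identityʳ k)))
      ; lower = low
      ; upper = up
      }
      where
      low : ∀ n → n < k → signed n ≡ t n
      low n n<k with t n in eq | t-sign n
      ... | _ | pos = C⇒signed (ℕ.<⇒≢ n<k) (proj₂ C≐ (inj₁ (t⇒A n eq , z≤n , ℕ.<⇒≤ n<k)))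
      ... | _ | neg = D⇒signed (ℕ.<⇒≢ n<k) (proj₂ D≐ (inj₁ (t⇒B n eq , z≤n , ℕ.<⇒≤ n<k)))
      up : ∀ j → 0 < j → j ≤ k → signed (k + j) ≡ - t j
      up j 0<j j≤k with t j in eq | t-sign j
      ... | _ | pos = D⇒signed (λ e → ℕ.<⇒≢ (ℕ.m<m+n k 0<j) (sym e)) (proj₂ D≐ (inj₂ (j , (t⇒A j eq , z≤n , j≤k) , refl)))
      ... | _ | neg = C⇒signed (λ e → ℕ.<⇒≢ (ℕ.m<m+n k 0<j) (sym e)) (proj₂ C≐ (inj₂ (j , (t⇒B j eq , z≤n , j≤k) , refl)))

  shape⇒equal-R : Shape m r signed → R C? ≗ R D?
  shape⇒equal-R shape = masked⇒R≗ (shape⇒masked signed-r signed-beyond shape)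

theorem7 : (m r : ℕ) (C D : Pred ℕ 0ℓ) (C? : Decidable C) (D? : Decidable D) →
    C ∪ D ≐ [ 0 ⋯ m ] → C ∩ D ≐ ｛ r ｝ → 0 ∈ C →
    ((n : ℕ) → 0 < n → R C? n ≡ R D? n)
      ⇔ (∃[ l ] (C ≐ Aₗ (2 * l) ∪ ((2 ^ (2 * l) ∸ 1) +ˢ Bₗ (2 * l))
               × D ≐ Bₗ (2 * l) ∪ ((2 ^ (2 * l) ∸ 1) +ˢ Aₗ (2 * l))))
theorem7 m r C D C? D? C∪D≐[0⋯m] C∩D≐｛r｝ 0∈C = mk⇔
  (λ eq → shape⇒glued (equal-R⇒shape 0∈C eq))
  (λ (l , glued) n _ → shape⇒equal-R
    (glued⇒shape l (2 ^ (2 * l) ∸ 1) (ℕ.m+[n∸m]≡n (ℕ.m^n>0 2 (2 * l))) glued) n)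
  where open Partition m r C? D? C∪D≐[0⋯m] C∩D≐｛r｝
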